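{- Every finite nilpotent DRR-detecting group is a $p$-group (for some prime $p$).
   Context: For a subset $S$ of a finite group $G$, the Cayley digraph $\mathrm{Cay}(G,S)$ has vertex set $G$ and a directed edge from $g_1$ to $g_2$ iff $g_2 = s g_1$ for some $s \in S$. $\mathrm{Aut}(G,S) = \{\varphi \in \mathrm{Aut}(G) : \varphi(S) = S\}$. A digraph $\Gamma$ is a DRR of $G$ if $\mathrm{Aut}(\Gamma) \cong G$ and acts regularly on the vertices. $G$ is DRR-detecting if for every subset $S \subseteq G$, $\mathrm{Aut}(G,S)=\{1\}$ implies $\mathrm{Cay}(G,S)$ is a DRR. -}

module Defs where

open import Data.Nat using (ℕ; _^_)
open import Data.Nat.Primality using (Prime)
open import Data.Fin using (Fin)
open import Data.Fin.Subset using (Subset; _∈_)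
open import Data.Product using (Σ; ∃; ∃-syntax; _×_; _,_)
open import Relation.Binary.PropositionalEquality using (_≡_)
open import Function.Bundles using (_⇔_)

-- A finite group of order n, with carrier Fin n (every finite group is
-- isomorphic to one of this form).
record FinGroup (n : ℕ) : Set where
  field
    _∙_     : Fin n → Fin n → Fin n
    ε       : Fin n
    _⁻¹     : Fin n → Fin n
    assoc   : ∀ x y z → (x ∙ y) ∙ z ≡ x ∙ (y ∙ z)
    identˡ  : ∀ x → ε ∙ x ≡ x
    identʳ  : ∀ x → x ∙ ε ≡ x
    inverseˡ : ∀ x → (x ⁻¹) ∙ x ≡ ε
    inverseʳ : ∀ x → x ∙ (x ⁻¹) ≡ ε
  infixl 7 _∙_
  infix 8 _⁻¹

  comm : Fin n → Fin n → Fin n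
  comm x y = x ∙ y ∙ x ⁻¹ ∙ y ⁻¹

module _ {n : ℕ} (G : FinGroup n) where
  open FinGroup G

  record GroupAut : Set where
    field
      to      : Fin n → Fin n
      from    : Fin n → Fin n
      to-from : ∀ x → to (from x) ≡ x
      from-to : ∀ x → from (to x) ≡ x
      hom     : ∀ x y → to (x ∙ y) ≡ to x ∙ to y

  Stabilises : GroupAut → Subset n → Set
  Stabilises φ S = ∀ x → (x ∈ S) ⇔ (GroupAut.to φ x ∈ S)

  AutGS-trivial : Subset n → Set
  AutGS-trivial S = ∀ (φ : GroupAut) → Stabilises φ S → ∀ x → GroupAut.to φ x ≡ x

  CayEdge : Subset n → Fin n → Fin n → Set
  CayEdge S g₁ g₂ = ∃[ s ] (s ∈ S × g₂ ≡ s ∙ g₁)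

  -- Upper central series: Z₀ = {1}, Z_{i+1} = {x : [x,y] ∈ Z_i for all y}
  -- (i.e. Z_{i+1}/Z_i = Z(G/Z_i)).
  UpperCentral : ℕ → Fin n → Set
  UpperCentral ℕ.zero    x = x ≡ ε
  UpperCentral (ℕ.suc i) x = ∀ y → UpperCentral i (comm x y)

  Nilpotent : Set
  Nilpotent = ∃[ c ] (∀ x → UpperCentral c x)

  IsPGroup : Set
  IsPGroup = ∃[ p ] (Prime p × ∃[ k ] (n ≡ p ^ k))

Digraph : ℕ → Set₁
Digraph n = Fin n → Fin n → Set

module _ {n : ℕ} (Γ : Digraph n) where
  record DigraphAut : Set where
    field
      to      : Fin n → Fin n
      from    : Fin n → Fin n
      to-from : ∀ x → to (from x) ≡ x
      from-to : ∀ x → from (to x) ≡ x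
      arcs    : ∀ x y → Γ x y ⇔ Γ (to x) (to y)

  ActsRegularly : Set
  ActsRegularly =
    (∀ u v → ∃[ σ ] (DigraphAut.to σ u ≡ v)) ×
    (∀ (σ τ : DigraphAut) u → DigraphAut.to σ u ≡ DigraphAut.to τ u →
       ∀ x → DigraphAut.to σ x ≡ DigraphAut.to τ x)

IsDRR : {n : ℕ} (G : FinGroup n) → Subset n → Set
IsDRR G S = ActsRegularly (CayEdge G S)

DRRDetecting : {n : ℕ} → FinGroup n → Set
DRRDetecting {n} G = ∀ (S : Subset n) → AutGS-trivial G S → IsDRR G S

{-# OPTIONS --safe #-}
module Submission where

-- Write A and B for the images of x ↦ xᵐ and x ↦ xᵐ′, where m and m′ are complementary
-- idempotents modulo an exponent pᵏb of G with p ∤ b. Climbing the upper central series shows that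
-- these power maps are homomorphisms, so G = A × B with both factors characteristic. If B is
-- trivial then G has exponent pᵏ, and a chain of subgroups, each normal of index p in the next,
-- shows that |G| is a power of p.
--
-- Otherwise choose irredundant generators a₀, …, aₑ of A and b₀, …, b_d of B, with e ≤ d after
-- exchanging A and B if needed. Take the connection set to consist of (a₀, 1), (1, b₁),
-- (a₀, bᵢ) for i ≥ 2, (aᵢ, bᵢ) for i ≥ 1, and the cosets A b₀ and A bᵢbᵢ₊₁ for i ≥ 1.
-- An automorphism of G that preserves it fixes a₀, hence b₁, hence (along the path of the
-- bᵢbᵢ₊₁) every generator. But outside A × ⟨b₁, …, b_d⟩ the set is a union of cosets of A,
-- so multiplying by a₀ on A × ⟨b₁, …, b_d⟩ only is a digraph automorphism with fixed points.

open import Algebra.Bundles using (Group)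
open import Data.Fin as Fin using (Fin; toℕ; fromℕ<; inject≤; punchIn; punchOut; combine; remQuot)
open import Data.Fin.Subset using (Subset; _∈_)
open import Data.List using ([]; _∷_)
open import Data.List.Relation.Unary.All using (All; []; _∷_)
open import Data.Nat using (ℕ; zero; suc; pred; _+_; _*_; _∸_; _^_; _!; _≤_; _<_; z≤n; s≤s; NonZero; >-nonZero; nonTrivial⇒n>1)
open import Data.Nat.Coprimality as Coprime using (Coprime; coprime-Bézout; coprime-divisor; prime⇒coprime)
open import Data.Nat.DivMod using (_/_; _%_; m≡m%n+[m/n]*n; m%n<n)
open import Data.Nat.Divisibility using (_∣_; divides; ∣-trans; m∣m*n; m≤n⇒m!∣n!; *-monoʳ-∣)
open import Data.Nat.GCD using (module Bézout)
open import Data.Nat.ListAction using (product)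
open import Data.Nat.Primality using (Prime; prime[2]; prime⇒nonZero; prime⇒nonTrivial; prime⇒irreducible)
open import Data.Nat.Primality.Factorisation using (factorise; PrimeFactorisation)
open import Data.Nat.Tactic.RingSolver using (solve-∀)
open import Data.Product using (∃; ∃₂; ∃-syntax; _×_; _,_; proj₁; proj₂)
open import Data.Sum using (_⊎_; inj₁; inj₂)
open import Data.Vec using (tabulate)
open import Data.Vec.Properties using (lookup∘tabulate; lookup⇒[]=; []=⇒lookup)
open import Effect.Monad using (RawMonad)
open import Function using (_∘_; id)
open import Function.Bundles using (_⇔_; mk⇔; Equivalence)
open import Function.Definitions using (Injective)
open import Level using (0ℓ)
open import Relation.Binary.Definitions using (tri<; tri≈; tri>)
open import Relation.Nullary using (¬_; Dec; yes; no; does; contradiction; ¬?; _×-dec_)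
open import Relation.Nullary.Decidable using (dec-true; decidable-stable; ¬¬-excluded-middle)
open import Relation.Nullary.Negation using (¬¬-Monad)
open import Tactic.MonoidSolver using (solve)
import Algebra.Properties.Group
import Algebra.Properties.Monoid.Mult
import Data.Fin.Properties as Fin
import Data.Nat.Properties as ℕ
import Relation.Binary.Reasoning.Setoid

open import Defs

-- Powers and commuting elements in a group.

module GroupPowers (𝔾 : Group 0ℓ 0ℓ) where
  open Group 𝔾
  open Algebra.Properties.Group 𝔾
  open Algebra.Properties.Monoid.Mult monoid renaming (_×_ to infixr 8 _⋆_) public
  open Relation.Binary.Reasoning.Setoid setoid

  Commute : Carrier → Carrier → Set
  Commute x y = x ∙ y ≈ y ∙ x

  assoc-inner : ∀ a b c d → a ∙ b ∙ (c ∙ d) ≈ a ∙ (b ∙ c) ∙ d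
  assoc-inner a b c d = solve monoid

  commute-∙ : ∀ {x y z} → Commute x y → Commute x z → Commute x (y ∙ z)
  commute-∙ {x} {y} {z} xy xz = begin
    x ∙ (y ∙ z)  ≈⟨ assoc x y z ⟨
    x ∙ y ∙ z    ≈⟨ ∙-congʳ xy ⟩
    y ∙ x ∙ z    ≈⟨ assoc y x z ⟩
    y ∙ (x ∙ z)  ≈⟨ ∙-congˡ xz ⟩
    y ∙ (z ∙ x)  ≈⟨ assoc y z x ⟨
    y ∙ z ∙ x    ∎

  commute-ε : ∀ x → Commute x ε
  commute-ε x = trans (identityʳ x) (sym (identityˡ x))

  commute-⁻¹ : ∀ {x y} → Commute x y → Commute x (y ⁻¹)
  commute-⁻¹ {x} {y} xy = begin
    x ∙ y ⁻¹                ≈⟨ ∙-congʳ (\\-leftDividesʳ y x) ⟨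
    y ⁻¹ ∙ (y ∙ x) ∙ y ⁻¹   ≈⟨ ∙-congʳ (∙-congˡ xy) ⟨
    y ⁻¹ ∙ (x ∙ y) ∙ y ⁻¹   ≈⟨ assoc (y ⁻¹) (x ∙ y) (y ⁻¹) ⟩
    y ⁻¹ ∙ (x ∙ y ∙ y ⁻¹)   ≈⟨ ∙-congˡ (//-rightDividesʳ y x) ⟩
    y ⁻¹ ∙ x                ∎

  commute-⋆ : ∀ {x y} k → Commute x y → Commute x (k ⋆ y)
  commute-⋆ zero    xy = commute-ε _
  commute-⋆ (suc k) xy = commute-∙ xy (commute-⋆ k xy)

  ⋆-∙ : ∀ {x y} k → Commute x y → k ⋆ (x ∙ y) ≈ k ⋆ x ∙ k ⋆ y
  ⋆-∙ zero xy = sym (identityˡ ε)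
  ⋆-∙ {x} {y} (suc k) xy = begin
    x ∙ y ∙ k ⋆ (x ∙ y)        ≈⟨ ∙-congˡ (⋆-∙ k xy) ⟩
    x ∙ y ∙ (k ⋆ x ∙ k ⋆ y)    ≈⟨ assoc-inner x y (k ⋆ x) (k ⋆ y) ⟩
    x ∙ (y ∙ k ⋆ x) ∙ k ⋆ y    ≈⟨ ∙-congʳ (∙-congˡ (commute-⋆ k (sym xy))) ⟩
    x ∙ (k ⋆ x ∙ y) ∙ k ⋆ y    ≈⟨ assoc-inner x (k ⋆ x) y (k ⋆ y) ⟨
    x ∙ k ⋆ x ∙ (y ∙ k ⋆ y)    ∎

  ⋆-ε : ∀ k → k ⋆ ε ≈ ε
  ⋆-ε zero    = refl
  ⋆-ε (suc k) = trans (identityˡ (k ⋆ ε)) (⋆-ε k)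

  conj-∙ : ∀ x y z → x ∙ (y ∙ z) ∙ x ⁻¹ ≈ x ∙ y ∙ x ⁻¹ ∙ (x ∙ z ∙ x ⁻¹)
  conj-∙ x y z = begin
    x ∙ (y ∙ z) ∙ x ⁻¹                   ≈⟨ ∙-congʳ (∙-congˡ (∙-congˡ (\\-leftDividesʳ x z))) ⟨
    x ∙ (y ∙ (x ⁻¹ ∙ (x ∙ z))) ∙ x ⁻¹    ≈⟨ reassoc x y (x ⁻¹) z ⟩
    x ∙ y ∙ x ⁻¹ ∙ (x ∙ z ∙ x ⁻¹)        ∎
    where
    reassoc : ∀ a b c d → a ∙ (b ∙ (c ∙ (a ∙ d))) ∙ c ≈ a ∙ b ∙ c ∙ (a ∙ d ∙ c)
    reassoc a b c d = solve monoid

  conj-ε : ∀ x → x ∙ ε ∙ x ⁻¹ ≈ ε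
  conj-ε x = trans (∙-congʳ (identityʳ x)) (inverseʳ x)

  ⋆-conj : ∀ x y k → k ⋆ (x ∙ y ∙ x ⁻¹) ≈ x ∙ k ⋆ y ∙ x ⁻¹
  ⋆-conj x y zero    = sym (conj-ε x)
  ⋆-conj x y (suc k) = trans (∙-congˡ (⋆-conj x y k)) (sym (conj-∙ x y (k ⋆ y)))

  ⋆-⁻¹ : ∀ x k → k ⋆ (x ⁻¹) ≈ (k ⋆ x) ⁻¹
  ⋆-⁻¹ x k = inverseʳ-unique (k ⋆ x) (k ⋆ (x ⁻¹)) (begin
    k ⋆ x ∙ k ⋆ (x ⁻¹)  ≈⟨ ⋆-∙ k (trans (inverseʳ x) (sym (inverseˡ x))) ⟨
    k ⋆ (x ∙ x ⁻¹)      ≈⟨ ×-congʳ k (inverseʳ x) ⟩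
    k ⋆ ε               ≈⟨ ⋆-ε k ⟩
    ε                   ∎)

  -- The hypotheses say that z ∙ y is a conjugate of y.
  commuting-quotient-order : ∀ {x y z} k → Commute z y → x ∙ y ≈ z ∙ (y ∙ x) →
                             k ⋆ y ≈ ε → k ⋆ z ≈ ε
  commuting-quotient-order {x} {y} {z} k zy xy≈zyx ky≈ε = begin
    k ⋆ z                   ≈⟨ identityʳ (k ⋆ z) ⟨
    k ⋆ z ∙ ε               ≈⟨ ∙-congˡ ky≈ε ⟨
    k ⋆ z ∙ k ⋆ y           ≈⟨ ⋆-∙ k zy ⟨
    k ⋆ (z ∙ y)             ≈⟨ ×-congʳ k (//-rightDividesʳ x (z ∙ y)) ⟨
    k ⋆ (z ∙ y ∙ x ∙ x ⁻¹)  ≈⟨ ×-congʳ k (∙-congʳ (trans (assoc z y x) (sym xy≈zyx))) ⟩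
    k ⋆ (x ∙ y ∙ x ⁻¹)      ≈⟨ ⋆-conj x y k ⟩
    x ∙ k ⋆ y ∙ x ⁻¹        ≈⟨ ∙-congʳ (∙-congˡ ky≈ε) ⟩
    x ∙ ε ∙ x ⁻¹            ≈⟨ conj-ε x ⟩
    ε                       ∎

  -- This is the hypothesis of `commuting-quotient-order` with `y ⁻¹` and `x` in place of `x` and
  -- `y`, so that lemma also bounds the order of `z` by an exponent of `x`.
  quotient-⁻¹ : ∀ {x y z} → Commute z y → x ∙ y ≈ z ∙ (y ∙ x) → y ⁻¹ ∙ x ≈ z ∙ (x ∙ y ⁻¹)
  quotient-⁻¹ {x} {y} {z} zy xy≈zyx = begin
    y ⁻¹ ∙ x                       ≈⟨ ∙-congˡ (//-rightDividesʳ y x) ⟨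
    y ⁻¹ ∙ (x ∙ y ∙ y ⁻¹)          ≈⟨ ∙-congˡ (∙-congʳ xy≈zyx) ⟩
    y ⁻¹ ∙ (z ∙ (y ∙ x) ∙ y ⁻¹)    ≈⟨ reassoc (y ⁻¹) z y x ⟩
    y ⁻¹ ∙ z ∙ (y ∙ (x ∙ y ⁻¹))    ≈⟨ ∙-congʳ (commute-⁻¹ zy) ⟨
    z ∙ y ⁻¹ ∙ (y ∙ (x ∙ y ⁻¹))    ≈⟨ assoc z (y ⁻¹) (y ∙ (x ∙ y ⁻¹)) ⟩
    z ∙ (y ⁻¹ ∙ (y ∙ (x ∙ y ⁻¹)))  ≈⟨ ∙-congˡ (\\-leftDividesʳ y (x ∙ y ⁻¹)) ⟩
    z ∙ (x ∙ y ⁻¹)                 ∎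
    where
    reassoc : ∀ a b c d → a ∙ (b ∙ (c ∙ d) ∙ a) ≈ a ∙ b ∙ (c ∙ (d ∙ a))
    reassoc a b c d = solve monoid

open import Relation.Binary.PropositionalEquality

-- Normal subgroups and quotient groups.

module _ {n : ℕ} (G : FinGroup n) where
  open FinGroup G

  record IsNormalSubgroup (N : Fin n → Set) : Set where
    field
      ε-closed  : N ε
      ∙-closed  : ∀ {x y} → N x → N y → N (x ∙ y)
      ⁻¹-closed : ∀ {x} → N x → N (x ⁻¹)
      conj-closed : ∀ g {x} → N x → N (g ∙ x ∙ g ⁻¹)

  group : Group 0ℓ 0ℓ
  group = record
    { Carrier = Fin n
    ; _≈_ = _≡_
    ; _∙_ = _∙_
    ; ε = ε
    ; _⁻¹ = _⁻¹
    ; isGroup = record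
      { isMonoid = record
        { isSemigroup = record
          { isMagma = record { isEquivalence = isEquivalence ; ∙-cong = cong₂ _∙_ }
          ; assoc = assoc
          }
        ; identity = identˡ , identʳ
        }
      ; inverse = inverseˡ , inverseʳ
      ; ⁻¹-cong = cong _⁻¹
      }
    }

module Quotient {n : ℕ} (G : FinGroup n) {N : Fin n → Set} (N-normal : IsNormalSubgroup G N) where
  open FinGroup G
  open IsNormalSubgroup N-normal
  open Algebra.Properties.Group (group G)
  open Group (group G) using (monoid)

  infix 4 _≈_
  _≈_ : Fin n → Fin n → Set
  x ≈ y = N (x ∙ y ⁻¹)

  ≈-reflexive : ∀ {x y} → x ≡ y → x ≈ y
  ≈-reflexive {x} refl = subst N (sym (inverseʳ x)) ε-closed

  private
    ≈-sym : ∀ {x y} → x ≈ y → y ≈ x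
    ≈-sym {x} {y} p = subst N (⁻¹-anti-homo-// x y) (⁻¹-closed p)

    ≈-trans : ∀ {x y z} → x ≈ y → y ≈ z → x ≈ z
    ≈-trans {x} {y} {z} p q = subst N eq (∙-closed p q)
      where
      eq : x ∙ y ⁻¹ ∙ (y ∙ z ⁻¹) ≡ x ∙ z ⁻¹
      eq = trans (assoc x (y ⁻¹) (y ∙ z ⁻¹)) (cong (x ∙_) (\\-leftDividesʳ y (z ⁻¹)))

    ∙-cong : ∀ {x y u v} → x ≈ y → u ≈ v → (x ∙ u) ≈ (y ∙ v)
    -- Normality enters here: conjugating `u ∙ v ⁻¹` by `x` lets it cancel against `x ∙ y ⁻¹`.
    ∙-cong {x} {y} {u} {v} p q = subst N eq (∙-closed (conj-closed x q) p)
      where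
      reassoc : ∀ a b c d e → a ∙ (b ∙ c) ∙ d ∙ (a ∙ e) ≡ a ∙ b ∙ c ∙ (d ∙ (a ∙ e))
      reassoc a b c d e = solve monoid

      eq : x ∙ (u ∙ v ⁻¹) ∙ x ⁻¹ ∙ (x ∙ y ⁻¹) ≡ x ∙ u ∙ (y ∙ v) ⁻¹
      eq = begin
        x ∙ (u ∙ v ⁻¹) ∙ x ⁻¹ ∙ (x ∙ y ⁻¹)  ≡⟨ reassoc x u (v ⁻¹) (x ⁻¹) (y ⁻¹) ⟩
        x ∙ u ∙ v ⁻¹ ∙ (x ⁻¹ ∙ (x ∙ y ⁻¹))  ≡⟨ cong (x ∙ u ∙ v ⁻¹ ∙_) (\\-leftDividesʳ x (y ⁻¹)) ⟩
        x ∙ u ∙ v ⁻¹ ∙ y ⁻¹                 ≡⟨ assoc (x ∙ u) (v ⁻¹) (y ⁻¹) ⟩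
        x ∙ u ∙ (v ⁻¹ ∙ y ⁻¹)               ≡⟨ cong (x ∙ u ∙_) (⁻¹-anti-homo-∙ y v) ⟨
        x ∙ u ∙ (y ∙ v) ⁻¹                  ∎
        where open ≡-Reasoning

    ⁻¹-cong : ∀ {x y} → x ≈ y → (x ⁻¹) ≈ (y ⁻¹)
    ⁻¹-cong {x} {y} p = subst N eq (conj-closed (x ⁻¹) (≈-sym p))
      where
      eq : x ⁻¹ ∙ (y ∙ x ⁻¹) ∙ x ⁻¹ ⁻¹ ≡ x ⁻¹ ∙ y ⁻¹ ⁻¹
      eq = begin
        x ⁻¹ ∙ (y ∙ x ⁻¹) ∙ x ⁻¹ ⁻¹  ≡⟨ cong (_∙ x ⁻¹ ⁻¹) (assoc (x ⁻¹) y (x ⁻¹)) ⟨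
        x ⁻¹ ∙ y ∙ x ⁻¹ ∙ x ⁻¹ ⁻¹    ≡⟨ //-rightDividesʳ (x ⁻¹) (x ⁻¹ ∙ y) ⟩
        x ⁻¹ ∙ y                     ≡⟨ cong (x ⁻¹ ∙_) (⁻¹-involutive y) ⟨
        x ⁻¹ ∙ y ⁻¹ ⁻¹               ∎
        where open ≡-Reasoning

  -- The carrier and the operations stay those of `G`; only equality is coarsened. Identities of `G`
  -- thus hold in the quotient at once, with no choice of coset representatives.
  quotient : Group 0ℓ 0ℓ
  quotient = record
    { Carrier = Fin n
    ; _≈_ = _≈_
    ; _∙_ = _∙_
    ; ε = ε
    ; _⁻¹ = _⁻¹
    ; isGroup = record
      { isMonoid = record
        { isSemigroup = record
          { isMagma = record
            { isEquivalence = record { refl = ≈-reflexive refl ; sym = ≈-sym ; trans = ≈-trans }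
            ; ∙-cong = ∙-cong
            }
          ; assoc = λ x y z → ≈-reflexive (assoc x y z)
          }
        ; identity = (λ x → ≈-reflexive (identˡ x)) , (λ x → ≈-reflexive (identʳ x))
        }
      ; inverse = (λ x → ≈-reflexive (inverseˡ x)) , (λ x → ≈-reflexive (inverseʳ x))
      ; ⁻¹-cong = ⁻¹-cong
      }
    }

  ≈ε⇒∈ : ∀ {x} → x ≈ ε → N x
  ≈ε⇒∈ {x} = subst N (trans (cong (x ∙_) ε⁻¹≈ε) (identʳ x))

  open GroupPowers (group G) using (_⋆_)
  open GroupPowers quotient using () renaming (_⋆_ to _⋆/_)

  ⋆/≡⋆ : ∀ k x → k ⋆/ x ≡ k ⋆ x
  ⋆/≡⋆ zero    x = refl
  ⋆/≡⋆ (suc k) x = cong (x ∙_) (⋆/≡⋆ k x)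

-- The upper central series.

module UpperCentralSeries {n : ℕ} (G : FinGroup n) where
  open FinGroup G
  open Algebra.Properties.Group (group G)
  open GroupPowers (group G)

  comm≡ : ∀ x y → comm x y ≡ x ∙ y ∙ (y ∙ x) ⁻¹
  comm≡ x y = trans (assoc (x ∙ y) (x ⁻¹) (y ⁻¹)) (cong (x ∙ y ∙_) (sym (⁻¹-anti-homo-∙ y x)))

  comm-∙ : ∀ x y → comm x y ∙ (y ∙ x) ≡ x ∙ y
  comm-∙ x y = trans (cong (_∙ (y ∙ x)) (comm≡ x y)) (//-rightDividesˡ (y ∙ x) (x ∙ y))

  comm≡ε⇒commute : ∀ {x y} → comm x y ≡ ε → Commute x y
  comm≡ε⇒commute {x} {y} eq = x∙y⁻¹≈ε⇒x≈y (x ∙ y) (y ∙ x) (trans (sym (comm≡ x y)) eq)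

  -- Induction on `i`: Zᵢ₊₁ is the centre modulo Zᵢ, so its closure properties are those of
  -- commuting elements in the quotient by Zᵢ. That quotient needs the normality of Zᵢ, hence the
  -- early signature.
  upperCentral-normal : ∀ i → IsNormalSubgroup G (UpperCentral G i)

  module ModUpperCentral (i : ℕ) where
    open Quotient G (upperCentral-normal i) public
    module Q where
      open Group quotient public
      open GroupPowers quotient public

    central⇒commute : ∀ {x} → UpperCentral G (suc i) x → ∀ y → Q.Commute x y
    central⇒commute {x} x∈ y = subst (UpperCentral G i) (comm≡ x y) (x∈ y)

    commute⇒central : ∀ {x} → (∀ y → Q.Commute x y) → UpperCentral G (suc i) x
    commute⇒central {x} x∈ y = subst (UpperCentral G i) (sym (comm≡ x y)) (x∈ y)

  upperCentral-normal zero = record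
    { ε-closed = refl
    ; ∙-closed = λ { refl refl → identˡ ε }
    ; ⁻¹-closed = λ { refl → ε⁻¹≈ε }
    ; conj-closed = λ { g refl → conj-ε g }
    }
  upperCentral-normal (suc i) = record
    { ε-closed = commute⇒central λ y → Q.sym (Q.commute-ε y)
    ; ∙-closed = λ p q → commute⇒central λ y →
        Q.sym (Q.commute-∙ (Q.sym (central⇒commute p y)) (Q.sym (central⇒commute q y)))
    ; ⁻¹-closed = λ p → commute⇒central λ y → Q.sym (Q.commute-⁻¹ (Q.sym (central⇒commute p y)))
    ; conj-closed = λ g {x} p → commute⇒central λ y →
        let conj≈x : g ∙ x ∙ g ⁻¹ Q.≈ x
            conj≈x = Q.trans (Q.∙-congʳ (Q.sym (central⇒commute p g)))
                             (≈-reflexive (//-rightDividesʳ g x))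
        in Q.trans (Q.∙-congʳ conj≈x) (Q.trans (central⇒commute p y) (Q.∙-congˡ (Q.sym conj≈x)))
    }
    where open ModUpperCentral i

  upperCentral-⋆ : ∀ i k {x} → UpperCentral G i x → UpperCentral G i (k ⋆ x)
  upperCentral-⋆ i zero    x∈ = IsNormalSubgroup.ε-closed (upperCentral-normal i)
  upperCentral-⋆ i (suc k) x∈ = IsNormalSubgroup.∙-closed (upperCentral-normal i) x∈ (upperCentral-⋆ i k x∈)

  -- Modulo Zᵢ the commutator is central, so it inherits the exponents of both x and y.
  module _ {m m′ : ℕ} (split : ∀ x → m ⋆ x ∙ m′ ⋆ x ≡ x) where

    commute-descent : ∀ {x y} → m′ ⋆ x ≡ ε → m ⋆ y ≡ ε →
                      ∀ i → UpperCentral G i (comm x y) → comm x y ≡ ε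
    commute-descent xε yε zero z∈ = z∈
    commute-descent {x} {y} xε yε (suc i) z∈ = commute-descent {x} {y} xε yε i (≈ε⇒∈ z≈ε)
      where
      open ModUpperCentral i

      z = comm x y

      power-ε : ∀ k u → k ⋆ u ≡ ε → k Q.⋆ u Q.≈ ε
      power-ε k u eq = ≈-reflexive (trans (⋆/≡⋆ k u) eq)

      xy≈zyx : x ∙ y Q.≈ z ∙ (y ∙ x)
      xy≈zyx = ≈-reflexive (sym (comm-∙ x y))

      m⋆z≈ε : m Q.⋆ z Q.≈ ε
      m⋆z≈ε = Q.commuting-quotient-order m (central⇒commute z∈ y) xy≈zyx (power-ε m y yε)

      m′⋆z≈ε : m′ Q.⋆ z Q.≈ ε
      m′⋆z≈ε = Q.commuting-quotient-order m′ (central⇒commute z∈ x)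
                 (Q.quotient-⁻¹ (central⇒commute z∈ y) xy≈zyx) (power-ε m′ x xε)

      -- Killed by both `m` and `m′`, the commutator vanishes by `split`. It has dropped from Zᵢ₊₁
      -- to Zᵢ, and the descent ends at Z₀.
      z≈ε : z Q.≈ ε
      z≈ε = Q.trans (≈-reflexive (trans (sym (split z)) (cong₂ _∙_ (sym (⋆/≡⋆ m z)) (sym (⋆/≡⋆ m′ z)))))
                    (Q.trans (Q.∙-cong m⋆z≈ε m′⋆z≈ε) (Q.identityˡ ε))

-- Complementary power maps are homomorphisms.

module ComplementaryPowers {n : ℕ} (G : FinGroup n) where
  open FinGroup G
  open Algebra.Properties.Group (group G)
  open GroupPowers (group G)
  open UpperCentralSeries G

  -- In terms of the exponent of `G`: `m + m′` is 1 and `m * m′` is 0 modulo it, so `m` and `m′` are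
  -- orthogonal idempotents.
  record Complementary (m m′ : ℕ) : Set where
    field
      split      : ∀ x → m ⋆ x ∙ m′ ⋆ x ≡ x
      annihilate : ∀ x → m ⋆ m′ ⋆ x ≡ ε

    annihilate′ : ∀ x → m′ ⋆ m ⋆ x ≡ ε
    annihilate′ x = begin
      m′ ⋆ m ⋆ x    ≡⟨ ×-assocˡ x m′ m ⟩
      (m′ * m) ⋆ x  ≡⟨ cong (_⋆ x) (ℕ.*-comm m′ m) ⟩
      (m * m′) ⋆ x  ≡⟨ ×-assocˡ x m m′ ⟨
      m ⋆ m′ ⋆ x    ≡⟨ annihilate x ⟩
      ε             ∎
      where open ≡-Reasoning

    killed⇒fixed : ∀ {x} → m′ ⋆ x ≡ ε → m ⋆ x ≡ x
    killed⇒fixed {x} eq = trans (sym (identʳ (m ⋆ x))) (trans (cong (m ⋆ x ∙_) (sym eq)) (split x))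

    fixed⇒killed : ∀ {x} → m ⋆ x ≡ x → m′ ⋆ x ≡ ε
    fixed⇒killed {x} eq = trans (cong (m′ ⋆_) (sym eq)) (annihilate′ x)

    idempotent : ∀ x → m ⋆ m ⋆ x ≡ m ⋆ x
    idempotent x = killed⇒fixed (annihilate′ x)

  swap : ∀ {m m′} → Complementary m m′ → Complementary m′ m
  swap {m} {m′} c = record
    { split = λ x → trans (commute-⋆ m (sym (commute-⋆ m′ refl))) (split x)
    ; annihilate = annihilate′
    }
    where open Complementary c

  -- Multiplicativity is asked only for a second factor in Zᵢ. In this form it can climb the series
  -- by induction, and at the top it becomes the homomorphism law.
  HomAt : ℕ → ℕ → Set
  HomAt k i = ∀ h {t} → UpperCentral G i t → k ⋆ (h ∙ t) ≡ k ⋆ h ∙ k ⋆ t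

  module _ (nilpotent : Nilpotent G) where

    -- `m ⋆ x` is killed by `m′` and `m′ ⋆ y` by `m`, so their commutator descends from the top of
    -- the series to `ε`.
    fixed-commute : ∀ {m m′} → Complementary m m′ → ∀ x y → Commute (m ⋆ x) (m′ ⋆ y)
    fixed-commute {m} {m′} c x y = comm≡ε⇒commute
      (commute-descent {m} {m′} split {m ⋆ x} {m′ ⋆ y} (annihilate′ x) (annihilate y)
        (proj₁ nilpotent) (proj₂ nilpotent _))
      where open Complementary c

    module _ {m m′ : ℕ} (c : Complementary m m′) (i : ℕ) (hom-m : HomAt m i) where
      open Complementary c
      private module Zᵢ = IsNormalSubgroup (upperCentral-normal i)

      private
        -- The part of Zᵢ fixed by `m`. Staying inside Zᵢ gives closure under products, through
        -- `hom-m`.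
        N : Fin n → Set
        N w = UpperCentral G i w × m′ ⋆ w ≡ ε

        N-normal : IsNormalSubgroup G N
        N-normal = record
          { ε-closed = Zᵢ.ε-closed , ⋆-ε m′
          ; ∙-closed = λ { {x} {y} (x∈ , x-killed) (y∈ , y-killed) → Zᵢ.∙-closed x∈ y∈ ,
              fixed⇒killed (trans (hom-m x y∈) (cong₂ _∙_ (killed⇒fixed x-killed) (killed⇒fixed y-killed))) }
          ; ⁻¹-closed = λ { {x} (x∈ , x-killed) → Zᵢ.⁻¹-closed x∈ ,
              trans (⋆-⁻¹ x m′) (trans (cong _⁻¹ x-killed) ε⁻¹≈ε) }
          ; conj-closed = λ { g {x} (x∈ , x-killed) → Zᵢ.conj-closed g x∈ , conj-killed g x-killed }
          }
          where
          conj-killed : ∀ g {x} → m′ ⋆ x ≡ ε → m′ ⋆ (g ∙ x ∙ g ⁻¹) ≡ ε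
          conj-killed g {x} eq = trans (⋆-conj g x m′) (trans (cong (λ w → g ∙ w ∙ g ⁻¹) eq) (conj-ε g))

        open IsNormalSubgroup N-normal
        open Quotient G N-normal
        module Q where
          open Group quotient public
          open GroupPowers quotient public

      -- The commutator of t and g lies in N, so modulo N the m′-th power of g ∙ t is trivial;
      -- but N consists of elements killed by m′, and x ↦ m′ ⋆ x is idempotent.
      killed-∙ : ∀ {g t} → m′ ⋆ g ≡ ε → m′ ⋆ t ≡ ε → UpperCentral G (suc i) t → m′ ⋆ (g ∙ t) ≡ ε
      killed-∙ {g} {t} g-killed t-killed t∈ =
        trans (sym (Complementary.idempotent (swap c) (g ∙ t))) (proj₂ (≈ε⇒∈ m′⋆gt≈ε))
        where
        w w′ : Fin n
        w = comm t g
        -- The conjugate of `g` by `t` is `w ∙ g`. Conjugating `w` by `g ⁻¹` moves it to the right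
        -- of `g`, where `HomAt` expects the factor from Zᵢ.
        w′ = g ⁻¹ ∙ w ∙ g ⁻¹ ⁻¹

        w′∈ : UpperCentral G i w′
        w′∈ = Zᵢ.conj-closed (g ⁻¹) (t∈ g)

        tgt⁻¹≡gw′ : t ∙ g ∙ t ⁻¹ ≡ g ∙ w′
        tgt⁻¹≡gw′ = begin
          t ∙ g ∙ t ⁻¹                         ≡⟨ //-rightDividesʳ (g ⁻¹) (t ∙ g ∙ t ⁻¹) ⟨
          t ∙ g ∙ t ⁻¹ ∙ g ⁻¹ ∙ g ⁻¹ ⁻¹        ≡⟨ \\-leftDividesˡ g (w ∙ g ⁻¹ ⁻¹) ⟨
          g ∙ (g ⁻¹ ∙ (w ∙ g ⁻¹ ⁻¹))           ≡⟨ cong (g ∙_) (assoc (g ⁻¹) w (g ⁻¹ ⁻¹)) ⟨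
          g ∙ w′                               ∎
          where open ≡-Reasoning

        -- `m` fixes `g`, hence also its conjugate `g ∙ w′`; since `m` is multiplicative on this
        -- product, it fixes `w′`.
        m⋆w′≡w′ : m ⋆ w′ ≡ w′
        m⋆w′≡w′ = begin
          m ⋆ w′                                   ≡⟨ \\-leftDividesʳ g (m ⋆ w′) ⟨
          g ⁻¹ ∙ (g ∙ m ⋆ w′)                      ≡⟨ cong (λ u → g ⁻¹ ∙ (u ∙ m ⋆ w′)) (killed⇒fixed g-killed) ⟨
          g ⁻¹ ∙ (m ⋆ g ∙ m ⋆ w′)                  ≡⟨ cong (g ⁻¹ ∙_) (hom-m g w′∈) ⟨
          g ⁻¹ ∙ m ⋆ (g ∙ w′)                      ≡⟨ cong (λ u → g ⁻¹ ∙ m ⋆ u) tgt⁻¹≡gw′ ⟨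
          g ⁻¹ ∙ m ⋆ (t ∙ g ∙ t ⁻¹)                ≡⟨ cong (g ⁻¹ ∙_) (⋆-conj t g m) ⟩
          g ⁻¹ ∙ (t ∙ m ⋆ g ∙ t ⁻¹)                ≡⟨ cong (λ u → g ⁻¹ ∙ (t ∙ u ∙ t ⁻¹)) (killed⇒fixed g-killed) ⟩
          g ⁻¹ ∙ (t ∙ g ∙ t ⁻¹)                    ≡⟨ cong (g ⁻¹ ∙_) tgt⁻¹≡gw′ ⟩
          g ⁻¹ ∙ (g ∙ w′)                          ≡⟨ \\-leftDividesʳ g w′ ⟩
          w′                                       ∎
          where open ≡-Reasoning

        gw′g⁻¹≡w : g ∙ w′ ∙ g ⁻¹ ≡ w
        gw′g⁻¹≡w = cong (_∙ g ⁻¹) (sym tgt⁻¹≡gw′)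

        w∈N : N w
        w∈N = subst N gw′g⁻¹≡w (conj-closed g (w′∈ , fixed⇒killed m⋆w′≡w′))

        tg≈gt : Q.Commute t g
        tg≈gt = subst N (comm≡ t g) w∈N

        m′⋆gt≈ε : m′ ⋆ (g ∙ t) ≈ ε
        m′⋆gt≈ε = Q.trans (≈-reflexive (sym (⋆/≡⋆ m′ (g ∙ t)))) (Q.trans (Q.⋆-∙ m′ (Q.sym tg≈gt))
          (≈-reflexive (trans (cong₂ _∙_ (trans (⋆/≡⋆ m′ g) g-killed) (trans (⋆/≡⋆ m′ t) t-killed)) (identˡ ε))))

    middle-exchange : ∀ a b c d → Commute b c → a ∙ b ∙ (c ∙ d) ≡ a ∙ c ∙ (b ∙ d)
    middle-exchange a b c d bc = begin
      a ∙ b ∙ (c ∙ d)  ≡⟨ assoc-inner a b c d ⟩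
      a ∙ (b ∙ c) ∙ d  ≡⟨ cong (λ w → a ∙ w ∙ d) bc ⟩
      a ∙ (c ∙ b) ∙ d  ≡⟨ assoc-inner a c b d ⟨
      a ∙ c ∙ (b ∙ d)  ∎
      where open ≡-Reasoning

    -- Sorting the parts of `h` and `t` gives `h ∙ t ≡ x ∙ y`. By `killed-∙`, `x` is killed by `m′`
    -- and `y` by `m`; so `x` and `y` commute, and the `m`-th power keeps `x` and erases `y`.
    hom-step : ∀ {m m′} → Complementary m m′ → ∀ i → HomAt m i → HomAt m′ i → HomAt m (suc i)
    hom-step {m} {m′} c i hom-m hom-m′ h {t} t∈ = begin
      m ⋆ (h ∙ t)                                  ≡⟨ cong (m ⋆_) ht≡xy ⟩
      m ⋆ (x ∙ y)                                  ≡⟨ ⋆-∙ m x-y-commute ⟩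
      m ⋆ x ∙ m ⋆ y                                ≡⟨ cong₂ _∙_ (killed⇒fixed x-killed) y-killed ⟩
      x ∙ ε                                        ≡⟨ identʳ x ⟩
      m ⋆ h ∙ m ⋆ t                                ∎
      where
      open Complementary c
      open ≡-Reasoning

      x y : Fin n
      x = m ⋆ h ∙ m ⋆ t
      y = m′ ⋆ h ∙ m′ ⋆ t

      x-killed : m′ ⋆ x ≡ ε
      x-killed = killed-∙ c i hom-m (annihilate′ h) (annihilate′ t) (upperCentral-⋆ (suc i) m t∈)

      y-killed : m ⋆ y ≡ ε
      y-killed = killed-∙ (swap c) i hom-m′ (annihilate h) (annihilate t) (upperCentral-⋆ (suc i) m′ t∈)

      x-y-commute : Commute x y
      x-y-commute = subst₂ Commute (killed⇒fixed x-killed)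
        (Complementary.killed⇒fixed (swap c) y-killed) (fixed-commute c x y)

      ht≡xy : h ∙ t ≡ x ∙ y
      ht≡xy = begin
        h ∙ t                                    ≡⟨ cong₂ _∙_ (split h) (split t) ⟨
        m ⋆ h ∙ m′ ⋆ h ∙ (m ⋆ t ∙ m′ ⋆ t)        ≡⟨ middle-exchange _ _ _ _ (sym (fixed-commute c t h)) ⟩
        x ∙ y                                    ∎

    -- The two maps climb together, because `hom-step` for either one uses both at the level below.
    hom-both : ∀ {m m′} → Complementary m m′ → ∀ i → HomAt m i × HomAt m′ i
    hom-both {m} {m′} c zero = base m , base m′
      where
      base : ∀ k → HomAt k zero
      base k h refl = begin
        k ⋆ (h ∙ ε)    ≡⟨ cong (k ⋆_) (identʳ h) ⟩
        k ⋆ h          ≡⟨ identʳ (k ⋆ h) ⟨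
        k ⋆ h ∙ ε      ≡⟨ cong (k ⋆ h ∙_) (⋆-ε k) ⟨
        k ⋆ h ∙ k ⋆ ε  ∎
        where open ≡-Reasoning
    hom-both c (suc i) with hom-both c i
    ... | hom-m , hom-m′ = hom-step c i hom-m hom-m′ , hom-step (swap c) i hom-m′ hom-m

    ⋆-hom : ∀ {m m′} → Complementary m m′ → ∀ x y → m ⋆ (x ∙ y) ≡ m ⋆ x ∙ m ⋆ y
    ⋆-hom c x y = proj₁ (hom-both c (proj₁ nilpotent)) x (proj₂ nilpotent y)

-- Arithmetic of coprime numbers and idempotents.

coprime-* : ∀ {a b c} → Coprime a c → Coprime b c → Coprime (a * b) c
coprime-* {a} {b} {c} a⊥c b⊥c {d} (d∣ab , d∣c) = b⊥c (coprime-divisor d⊥a d∣ab , d∣c)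
  where
  d⊥a : Coprime d a
  d⊥a (e∣d , e∣a) = a⊥c (e∣a , ∣-trans e∣d d∣c)

coprime-^ : ∀ {a c} k → Coprime a c → Coprime (a ^ k) c
coprime-^ {c = c} zero a⊥c = Coprime.1-coprimeTo c
coprime-^ (suc k) a⊥c = coprime-* a⊥c (coprime-^ k a⊥c)

distinct-primes-coprime : ∀ {p q} → Prime p → Prime q → p ≢ q → Coprime p q
distinct-primes-coprime p-prime q-prime p≢q (d∣p , d∣q)
  with prime⇒irreducible p-prime d∣p | prime⇒irreducible q-prime d∣q
... | inj₁ d≡1 | _         = d≡1
... | _        | inj₁ d≡1  = d≡1
... | inj₂ d≡p | inj₂ d≡q  = contradiction (trans (sym d≡p) d≡q) p≢q

prime-part : ∀ {p} → Prime p → ∀ {qs} → All Prime qs → ∃₂ λ k b → product qs ≡ p ^ k * b × Coprime p b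
prime-part {p} p-prime [] = 0 , 1 , refl , Coprime.sym (Coprime.1-coprimeTo p)
prime-part {p} p-prime {q ∷ qs} (q-prime ∷ qs-prime) with prime-part p-prime qs-prime | p ℕ.≟ q
... | k , b , eq , p⊥b | yes refl = suc k , b , trans (cong (p *_) eq) (sym (ℕ.*-assoc p (p ^ k) b)) , p⊥b
... | k , b , eq , p⊥b | no p≢q =
  k , q * b , trans (cong (q *_) eq) (swap-middle q (p ^ k) b) ,
  Coprime.sym (coprime-* (Coprime.sym (distinct-primes-coprime p-prime q-prime p≢q)) (Coprime.sym p⊥b))
  where
  swap-middle : ∀ q r b → q * (r * b) ≡ r * (q * b)
  swap-middle = solve-∀

k<p^k : ∀ {p} → Prime p → ∀ k → k < p ^ k
k<p^k p-prime zero    = s≤s z≤n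
k<p^k {p} p-prime (suc k) = begin-strict
  suc k        ≤⟨ k<p^k p-prime k ⟩
  p ^ k        <⟨ ℕ.m<m*n (p ^ k) p {{>-nonZero (ℕ.≤-<-trans z≤n (k<p^k p-prime k))}}
                            (nonTrivial⇒n>1 p {{prime⇒nonTrivial p-prime}}) ⟩
  p ^ k * p    ≡⟨ ℕ.*-comm (p ^ k) p ⟩
  p ^ suc k    ∎
  where open ℕ.≤-Reasoning

-- The Chinese remainder idempotents: `m` is 1 modulo `a` and 0 modulo `b`, and `m′` the reverse.
record IdempotentExponents (a b : ℕ) : Set where
  constructor idempotentExponents
  field
    m m′ c : ℕ
    b∣m  : b ∣ m
    a∣m′ : a ∣ m′
    m+m′ : m + m′ ≡ 1 + c * (a * b)

-- The Bézout summands of 1 are `x * a` and minus `y * b`. The sign is absorbed by the factor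
-- `pred (a * b)`, which is -1 modulo `a * b`.
bézout-exponents : ∀ x y a b → .{{NonZero (a * b)}} → 1 + y * b ≡ x * a → IdempotentExponents a b
bézout-exponents x y a b eq = idempotentExponents (y * b * pred (a * b)) (x * a) (y * b)
  (divides (y * pred (a * b)) (swap-last y b (pred (a * b)))) (divides x refl) (begin
    y * b * pred (a * b) + x * a              ≡⟨ cong (y * b * pred (a * b) +_) eq ⟨
    y * b * pred (a * b) + (1 + y * b)        ≡⟨ factor (y * b) (pred (a * b)) ⟩
    1 + y * b * suc (pred (a * b))            ≡⟨ cong (λ e → 1 + y * b * e) (ℕ.suc-pred (a * b)) ⟩
    1 + y * b * (a * b)                       ∎)
  where
  open ≡-Reasoning
  swap-last : ∀ y b e → y * b * e ≡ y * e * b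
  swap-last = solve-∀
  factor : ∀ u e → u * e + (1 + u) ≡ 1 + u * suc e
  factor = solve-∀

coprime⇒idempotentExponents : ∀ {a b} → .{{NonZero (a * b)}} → Coprime a b → IdempotentExponents a b
coprime⇒idempotentExponents {a} {b} {{ab≢0}} a⊥b with coprime-Bézout a⊥b
... | Bézout.+- x y eq = bézout-exponents x y a b eq
... | Bézout.-+ x y eq with bézout-exponents y x b a {{subst NonZero (ℕ.*-comm a b) ab≢0}} eq
...   | idempotentExponents m m′ c a∣m b∣m′ m+m′ = idempotentExponents m′ m c b∣m′ a∣m
        (trans (ℕ.+-comm m′ m) (trans m+m′ (cong (λ e → 1 + c * e) (ℕ.*-comm b a))))

-- Exponents, and the order of a nilpotent group of prime power exponent.

module Exponents {n : ℕ} (G : FinGroup n) where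
  open FinGroup G
  open Algebra.Properties.Group (group G)
  open GroupPowers (group G)
  open UpperCentralSeries G
  open ComplementaryPowers G

  ∣-⋆ : ∀ {k l x} → k ∣ l → k ⋆ x ≡ ε → l ⋆ x ≡ ε
  ∣-⋆ {k} {x = x} (divides q refl) eq = trans (sym (×-assocˡ x q k)) (trans (cong (q ⋆_) eq) (⋆-ε q))

  -- Among the powers 0 to `n` two coincide. The form `suc k` keeps the exponent positive, and
  -- `k < n` makes it a divisor of `n !`.
  order : ∀ x → ∃[ k ] k < n × suc k ⋆ x ≡ ε
  order x with Fin.pigeonhole (ℕ.n<1+n n) (λ i → toℕ i ⋆ x)
  ... | i , j , i<j , eq = toℕ j ∸ suc (toℕ i) , bound , sym (∙-cancelˡ (toℕ i ⋆ x) _ _ (begin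
    toℕ i ⋆ x ∙ ε                                      ≡⟨ identʳ (toℕ i ⋆ x) ⟩
    toℕ i ⋆ x                                          ≡⟨ eq ⟩
    toℕ j ⋆ x                                          ≡⟨ cong (_⋆ x) j≡i+k ⟩
    (toℕ i + suc (toℕ j ∸ suc (toℕ i))) ⋆ x            ≡⟨ ×-homo-+ x (toℕ i) _ ⟩
    toℕ i ⋆ x ∙ suc (toℕ j ∸ suc (toℕ i)) ⋆ x          ∎))
    where
    open ≡-Reasoning
    j≡i+k : toℕ j ≡ toℕ i + suc (toℕ j ∸ suc (toℕ i))
    j≡i+k = trans (sym (ℕ.m+[n∸m]≡n i<j)) (sym (ℕ.+-suc (toℕ i) _))
    bound : toℕ j ∸ suc (toℕ i) < n
    bound = ℕ.<-≤-trans (ℕ.∸-monoʳ-< {toℕ j} {suc (toℕ i)} {0} (s≤s z≤n) i<j) (ℕ.≤-pred (Fin.toℕ<n j))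

  exponent : ∀ x → (n !) ⋆ x ≡ ε
  exponent x with order x
  ... | k , k<n , eq = ∣-⋆ (∣-trans (m∣m*n {suc k} (k !)) (m≤n⇒m!∣n! k<n)) eq

  -- Primes are dropped from the product while the rest still kills `x`; the first rest that does
  -- not kill it gives `y`.
  prime-order-element : ∀ {ps x} → All Prime ps → product ps ⋆ x ≡ ε → x ≢ ε →
                        ∃₂ λ p y → Prime p × y ≢ ε × p ⋆ y ≡ ε
  prime-order-element {x = x} [] eq x≢ε = contradiction (trans (sym (×-homo-1 x)) eq) x≢ε
  prime-order-element {p ∷ ps} {x} (p-prime ∷ ps-prime) eq x≢ε with product ps ⋆ x Fin.≟ ε
  ... | yes eq′ = prime-order-element ps-prime eq′ x≢ε
  ... | no y≢ε  = p , product ps ⋆ x , p-prime , y≢ε , trans (×-assocˡ x p (product ps)) eq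

  complementary : ∀ {a b} → (∀ x → (a * b) ⋆ x ≡ ε) → (i : IdempotentExponents a b) →
                  Complementary (IdempotentExponents.m i) (IdempotentExponents.m′ i)
  complementary {a} {b} ab-exponent (idempotentExponents m m′ c (divides q refl) (divides q′ refl) m+m′) = record
    { split = λ x → begin
        m ⋆ x ∙ m′ ⋆ x           ≡⟨ ×-homo-+ x m m′ ⟨
        (m + m′) ⋆ x             ≡⟨ cong (_⋆ x) m+m′ ⟩
        x ∙ (c * (a * b)) ⋆ x    ≡⟨ cong (x ∙_) (∣-⋆ (divides c refl) (ab-exponent x)) ⟩
        x ∙ ε                    ≡⟨ identʳ x ⟩
        x                        ∎
    ; annihilate = λ x → trans (×-assocˡ x m m′)
        (∣-⋆ (divides (q * q′) (regroup q q′ a b)) (ab-exponent x))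
    }
    where
    open ≡-Reasoning
    regroup : ∀ q q′ a b → q * b * (q′ * a) ≡ q * q′ * (a * b)
    regroup = solve-∀

  record IsSubgroup (H : Fin n → Set) : Set where
    field
      ε-closed  : H ε
      ∙-closed  : ∀ {x y} → H x → H y → H (x ∙ y)

    ⋆-closed : ∀ k {x} → H x → H (k ⋆ x)
    ⋆-closed zero    x∈ = ε-closed
    ⋆-closed (suc k) x∈ = ∙-closed x∈ (⋆-closed k x∈)

    ⁻¹-closed : ∀ {x} → H x → H (x ⁻¹)
    ⁻¹-closed {x} x∈ with order x
    -- As `suc k` kills `x`, the inverse is the power `k ⋆ x`.
    ... | k , _ , eq = subst H (inverseʳ-unique x (k ⋆ x) eq) (⋆-closed k x∈)

    difference : ∀ x i y j {t} → 1 + y * j ≡ x * i → H (i ⋆ t) → H (j ⋆ t) → H t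
    difference x i y j {t} eq i∈ j∈ = subst H
      (trans (cong (λ k → k ⋆ t ∙ ((y * j) ⋆ t) ⁻¹) (sym eq)) (//-rightDividesʳ ((y * j) ⋆ t) t))
      (∙-closed (multiple x i∈) (⁻¹-closed (multiple y j∈)))
      where
      multiple : ∀ x {i} → H (i ⋆ t) → H ((x * i) ⋆ t)
      multiple x {i} i∈ = subst H (×-assocˡ t x i) (⋆-closed x i∈)

    coprime-powers : ∀ {i j t} → Coprime i j → H (i ⋆ t) → H (j ⋆ t) → H t
    coprime-powers {i} {j} {t} i⊥j i∈ j∈ with coprime-Bézout i⊥j
    ... | Bézout.+- x y eq = difference x _ y _ eq i∈ j∈
    ... | Bézout.-+ x y eq = difference y _ x _ eq j∈ i∈

  upperCentral? : ∀ i x → Dec (UpperCentral G i x)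
  upperCentral? zero    x = x Fin.≟ ε
  upperCentral? (suc i) x = Fin.all? λ y → upperCentral? i (comm x y)

  module _ {H : Fin n → Set} (H? : ∀ x → Dec (H x)) (H-subgroup : IsSubgroup H) where
    open IsSubgroup H-subgroup

    -- `H` contains Z₀, so descending from a term that leaves `H` reaches some Zⱼ inside `H` whose
    -- successor is not.
    escape : ∀ i {x} → UpperCentral G i x → ¬ H x →
             ∃₂ λ j t → UpperCentral G (suc j) t × ¬ H t × (∀ y → UpperCentral G j y → H y)
    escape zero x∈ x∉H = contradiction (subst H (sym x∈) ε-closed) x∉H
    escape (suc i) {x} x∈ x∉H with Fin.any? (λ y → upperCentral? i y ×-dec ¬? (H? y))
    ... | yes (y , y∈ , y∉H) = escape i y∈ y∉H
    ... | no none = i , x , x∈ , x∉H ,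
      λ y y∈ → decidable-stable (H? y) (λ y∉H → none (y , y∈ , y∉H))

    -- Repeated `p`-th powers of `t` stay in Zᵢ and end at `ε`, which is in `H`; `u` is the last one
    -- before they enter `H`.
    prime-step : ∀ p i k {t} → UpperCentral G i t → (p ^ k) ⋆ t ≡ ε → ¬ H t →
                 ∃[ u ] UpperCentral G i u × ¬ H u × H (p ⋆ u)
    prime-step p i zero {t} t∈ eq t∉H = contradiction (subst H (trans (sym eq) (×-homo-1 t)) ε-closed) t∉H
    prime-step p i (suc k) {t} t∈ eq t∉H with H? (p ⋆ t)
    ... | yes pt∈H = t , t∈ , t∉H , pt∈H
    ... | no pt∉H  = prime-step p i k (upperCentral-⋆ i p t∈)
      (trans (×-assocˡ t (p ^ k) p) (trans (cong (_⋆ t) (ℕ.*-comm (p ^ k) p)) eq)) pt∉H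

    -- Normalisers grow in a nilpotent group: for `u` in Zⱼ₊₁ with Zⱼ inside `H`, the conjugate of
    -- `h` by `u` is `comm u h ∙ h`, a product of elements of `H`.
    extension : ∀ {p} → Prime p → Nilpotent G → ∀ {k} → (∀ x → (p ^ k) ⋆ x ≡ ε) → ∀ {x} → ¬ H x →
                ∃[ t ] ¬ H t × H (p ⋆ t) × (∀ {h} → H h → H (t ∙ h ∙ t ⁻¹))
    extension {p} p-prime (c , Z-c) {k} pᵏ-exponent {x} x∉H with escape c (Z-c x) x∉H
    ... | j , t , t∈ , t∉H , Zⱼ⊆H with prime-step p (suc j) k t∈ (pᵏ-exponent t) t∉H
    ...   | u , u∈ , u∉H , pu∈H = u , u∉H , pu∈H , λ {h} h∈ →
      subst H (//-rightDividesˡ h (u ∙ h ∙ u ⁻¹)) (∙-closed (Zⱼ⊆H _ (u∈ h)) h∈)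

  -- The injective enumeration by `Fin N` carries the order of the subgroup.
  record EnumeratedSubgroup (N : ℕ) : Set where
    field
      enum      : Fin N → Fin n
      injective : Injective _≡_ _≡_ enum

    _∈H : Fin n → Set
    x ∈H = ∃[ i ] enum i ≡ x

    field
      isSubgroup : IsSubgroup _∈H

    _∈H? : ∀ x → Dec (x ∈H)
    x ∈H? = Fin.any? λ i → enum i Fin.≟ x

  trivialSubgroup : EnumeratedSubgroup 1
  trivialSubgroup = record
    { enum = λ _ → ε
    ; injective = λ { {Fin.zero} {Fin.zero} _ → refl }
    ; isSubgroup = record
      { ε-closed = Fin.zero , refl
      ; ∙-closed = λ { (_ , refl) (_ , refl) → Fin.zero , sym (identˡ ε) }
      }
    }

  module Extend {N} (E : EnumeratedSubgroup N) {p} (p-prime : Prime p) {t}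
                (t∉ : ¬ EnumeratedSubgroup._∈H E t) (pt∈ : EnumeratedSubgroup._∈H E (p ⋆ t))
                (normalises : ∀ {h} → EnumeratedSubgroup._∈H E h →
                              EnumeratedSubgroup._∈H E (t ∙ h ∙ t ⁻¹)) where
    open EnumeratedSubgroup E
    open IsSubgroup isSubgroup

    instance
      p≢0 : NonZero p
      p≢0 = prime⇒nonZero p-prime

    coset : Fin p → Fin N → Fin n
    coset i u = enum u ∙ toℕ i ⋆ t

    -- If two cosets met, `d ⋆ t` would lie in `H` for some 0 < `d` < `p`. As `d` is coprime to `p`
    -- and `p ⋆ t` is in `H`, so would `t`.
    coset-<-disjoint : ∀ {i j u v} → toℕ i < toℕ j → coset i u ≢ coset j v
    coset-<-disjoint {i} {j} {u} {v} i<j eq = t∉ (coprime-powers (prime⇒coprime p-prime d<p) pt∈ dt∈)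
      where
      d = toℕ j ∸ toℕ i

      instance
        d≢0 : NonZero d
        d≢0 = >-nonZero (ℕ.m<n⇒0<n∸m i<j)

      d<p : d < p
      d<p = ℕ.≤-<-trans (ℕ.m∸n≤m (toℕ j) (toℕ i)) (Fin.toℕ<n j)

      dt≡ : d ⋆ t ≡ enum v ⁻¹ ∙ enum u
      dt≡ = ∙-cancelʳ (toℕ i ⋆ t) _ _ (begin
        d ⋆ t ∙ toℕ i ⋆ t                        ≡⟨ ×-homo-+ t d (toℕ i) ⟨
        (d + toℕ i) ⋆ t                          ≡⟨ cong (_⋆ t) (ℕ.m∸n+n≡m (ℕ.<⇒≤ i<j)) ⟩
        toℕ j ⋆ t                                ≡⟨ \\-leftDividesʳ (enum v) (toℕ j ⋆ t) ⟨
        enum v ⁻¹ ∙ (enum v ∙ toℕ j ⋆ t)         ≡⟨ cong (enum v ⁻¹ ∙_) eq ⟨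
        enum v ⁻¹ ∙ (enum u ∙ toℕ i ⋆ t)         ≡⟨ assoc (enum v ⁻¹) (enum u) (toℕ i ⋆ t) ⟨
        enum v ⁻¹ ∙ enum u ∙ toℕ i ⋆ t           ∎)
        where open ≡-Reasoning

      dt∈ : (d ⋆ t) ∈H
      dt∈ = subst _∈H (sym dt≡) (∙-closed (⁻¹-closed (v , refl)) (u , refl))

    coset-injective : ∀ {i j u v} → coset i u ≡ coset j v → i ≡ j × u ≡ v
    coset-injective {i} {j} {u} {v} eq with ℕ.<-cmp (toℕ i) (toℕ j)
    ... | tri< i<j _ _ = contradiction eq (coset-<-disjoint i<j)
    ... | tri> _ _ j<i = contradiction (sym eq) (coset-<-disjoint j<i)
    ... | tri≈ _ i≡j _ with Fin.toℕ-injective i≡j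
    ...   | refl = refl , injective (∙-cancelʳ (toℕ i ⋆ t) (enum u) (enum v) eq)

    enum′ : Fin (p * N) → Fin n
    enum′ k = coset (proj₁ (remQuot {p} N k)) (proj₂ (remQuot {p} N k))

    enum′-injective : Injective _≡_ _≡_ enum′
    enum′-injective {k} {l} eq with coset-injective eq
    ... | i≡j , u≡v = begin
      k                                                  ≡⟨ Fin.combine-remQuot {p} N k ⟨
      combine (proj₁ (remQuot {p} N k)) (proj₂ (remQuot {p} N k))  ≡⟨ cong₂ combine i≡j u≡v ⟩
      combine (proj₁ (remQuot {p} N l)) (proj₂ (remQuot {p} N l))  ≡⟨ Fin.combine-remQuot {p} N l ⟩
      l                                                  ∎
      where open ≡-Reasoning

    enum′-combine : ∀ i u → enum′ (combine i u) ≡ coset i u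
    enum′-combine i u = cong (λ q → coset (proj₁ q) (proj₂ q)) (Fin.remQuot-combine i u)

    _∈H′ : Fin n → Set
    x ∈H′ = ∃[ k ] enum′ k ≡ x

    -- Division of `k` by `p`: the multiple of `p` is absorbed into `H`, and the remainder indexes
    -- the coset.
    power-coset : ∀ {h} k → h ∈H → (h ∙ k ⋆ t) ∈H′
    power-coset {h} k h∈ with ∙-closed h∈ (⋆-closed (k / p) pt∈)
    ... | u , u≡ = combine i u , (begin
      enum′ (combine i u)                              ≡⟨ enum′-combine i u ⟩
      enum u ∙ toℕ i ⋆ t                               ≡⟨ cong₂ (λ x l → x ∙ l ⋆ t) u≡ (Fin.toℕ-fromℕ< (m%n<n k p)) ⟩
      h ∙ (k / p) ⋆ p ⋆ t ∙ (k % p) ⋆ t                ≡⟨ assoc h _ _ ⟩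
      h ∙ ((k / p) ⋆ p ⋆ t ∙ (k % p) ⋆ t)              ≡⟨ cong (λ x → h ∙ (x ∙ (k % p) ⋆ t)) (×-assocˡ t (k / p) p) ⟩
      h ∙ ((k / p * p) ⋆ t ∙ (k % p) ⋆ t)              ≡⟨ cong (h ∙_) (×-homo-+ t (k / p * p) (k % p)) ⟨
      h ∙ (k / p * p + k % p) ⋆ t                      ≡⟨ cong (λ l → h ∙ l ⋆ t) k≡ ⟨
      h ∙ k ⋆ t                                        ∎)
      where
      open ≡-Reasoning
      i : Fin p
      i = fromℕ< (m%n<n k p)
      k≡ : k ≡ k / p * p + k % p
      k≡ = trans (m≡m%n+[m/n]*n k p) (ℕ.+-comm (k % p) (k / p * p))

    power-normalises : ∀ k {h} → h ∈H → ∃[ h′ ] h′ ∈H × k ⋆ t ∙ h ≡ h′ ∙ k ⋆ t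
    power-normalises zero {h} h∈ = h , h∈ , trans (identˡ h) (sym (identʳ h))
    power-normalises (suc k) {h} h∈ with power-normalises k h∈
    ... | h′ , h′∈ , eq = t ∙ h′ ∙ t ⁻¹ , normalises h′∈ , (begin
      t ∙ k ⋆ t ∙ h                       ≡⟨ assoc t (k ⋆ t) h ⟩
      t ∙ (k ⋆ t ∙ h)                     ≡⟨ cong (t ∙_) eq ⟩
      t ∙ (h′ ∙ k ⋆ t)                    ≡⟨ assoc t h′ (k ⋆ t) ⟨
      t ∙ h′ ∙ k ⋆ t                      ≡⟨ cong (t ∙ h′ ∙_) (\\-leftDividesʳ t (k ⋆ t)) ⟨
      t ∙ h′ ∙ (t ⁻¹ ∙ (t ∙ k ⋆ t))       ≡⟨ assoc (t ∙ h′) (t ⁻¹) (t ∙ k ⋆ t) ⟨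
      t ∙ h′ ∙ t ⁻¹ ∙ (t ∙ k ⋆ t)         ∎)
      where open ≡-Reasoning

    ∙-closed′ : ∀ {x y} → x ∈H′ → y ∈H′ → (x ∙ y) ∈H′
    ∙-closed′ (k , refl) (l , refl) = product-closed (proj₁ (remQuot {p} N k)) (proj₁ (remQuot {p} N l)) _ _
      where
      product-closed : ∀ i j u v → (coset i u ∙ coset j v) ∈H′
      product-closed i j u v with power-normalises (toℕ i) (v , refl)
      ... | h , h∈ , eq = subst _∈H′ (begin
        enum u ∙ h ∙ (toℕ i + toℕ j) ⋆ t                ≡⟨ cong (enum u ∙ h ∙_) (×-homo-+ t (toℕ i) (toℕ j)) ⟩
        enum u ∙ h ∙ (toℕ i ⋆ t ∙ toℕ j ⋆ t)            ≡⟨ assoc-inner (enum u) h (toℕ i ⋆ t) (toℕ j ⋆ t) ⟩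
        enum u ∙ (h ∙ toℕ i ⋆ t) ∙ toℕ j ⋆ t            ≡⟨ cong (λ x → enum u ∙ x ∙ toℕ j ⋆ t) eq ⟨
        enum u ∙ (toℕ i ⋆ t ∙ enum v) ∙ toℕ j ⋆ t       ≡⟨ assoc-inner (enum u) (toℕ i ⋆ t) (enum v) (toℕ j ⋆ t) ⟨
        coset i u ∙ coset j v                           ∎)
        (power-coset (toℕ i + toℕ j) (∙-closed (u , refl) h∈))
        where open ≡-Reasoning

    extended : EnumeratedSubgroup (p * N)
    extended = record
      { enum = enum′
      ; injective = enum′-injective
      ; isSubgroup = record
        { ε-closed = subst _∈H′ (identˡ ε) (power-coset 0 ε-closed)
        ; ∙-closed = ∙-closed′
        }
      }

  module _ {p} (p-prime : Prime p) (nilpotent : Nilpotent G) {k} (pᵏ-exponent : ∀ x → (p ^ k) ⋆ x ≡ ε) where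

    -- A proper subgroup is enlarged by a factor `p` until it is everything. Fuel cannot run out
    -- first: then `n ≤ j`, against `j < p ^ j` and `p ^ j ≤ n`.
    p-power-order-from : ∀ fuel j → n ≤ j + fuel → EnumeratedSubgroup (p ^ j) → ∃[ l ] n ≡ p ^ l
    p-power-order-from fuel j n≤j+fuel E with Fin.all? (EnumeratedSubgroup._∈H? E)
    ... | yes surjective = j , ℕ.≤-antisym (Fin.injective⇒≤ section-injective) (Fin.injective⇒≤ injective)
      where
      open EnumeratedSubgroup E
      section-injective : Injective _≡_ _≡_ (λ x → proj₁ (surjective x))
      section-injective {x} {y} eq =
        trans (sym (proj₂ (surjective x))) (trans (cong enum eq) (proj₂ (surjective y)))
    p-power-order-from zero j n≤j+0 E | no _ = contradiction
      (ℕ.≤-trans (Fin.injective⇒≤ injective) (subst (n ≤_) (ℕ.+-identityʳ j) n≤j+0)) (ℕ.<⇒≱ (k<p^k p-prime j))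
      where open EnumeratedSubgroup E
    p-power-order-from (suc fuel) j n≤ E | no proper
      with Fin.¬∀⟶∃¬ n _ (EnumeratedSubgroup._∈H? E) proper
    ... | x , x∉ with extension (EnumeratedSubgroup._∈H? E) (EnumeratedSubgroup.isSubgroup E)
                        p-prime nilpotent {k} pᵏ-exponent x∉
    ...   | t , t∉ , pt∈ , normalises = p-power-order-from fuel (suc j)
            (subst (n ≤_) (ℕ.+-suc j fuel) n≤) (Extend.extended E p-prime t∉ pt∈ normalises)

    p-power-order : ∃[ l ] n ≡ p ^ l
    p-power-order = p-power-order-from n 0 ℕ.≤-refl trivialSubgroup

-- Generated subgroups and irredundant generating families.

module Generation {n : ℕ} (G : FinGroup n) where
  open FinGroup G
  open Algebra.Properties.Group (group G)

  data ⟨_⟩ (P : Fin n → Set) : Fin n → Set where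
    generator : ∀ {x} → P x → ⟨ P ⟩ x
    ε-closed  : ⟨ P ⟩ ε
    ∙-closed  : ∀ {x y} → ⟨ P ⟩ x → ⟨ P ⟩ y → ⟨ P ⟩ (x ∙ y)
    ⁻¹-closed : ∀ {x} → ⟨ P ⟩ x → ⟨ P ⟩ (x ⁻¹)

  ⟨⟩-bind : ∀ {P Q : Fin n → Set} → (∀ {x} → P x → ⟨ Q ⟩ x) → ∀ {x} → ⟨ P ⟩ x → ⟨ Q ⟩ x
  ⟨⟩-bind f (generator p)  = f p
  ⟨⟩-bind f ε-closed       = ε-closed
  ⟨⟩-bind f (∙-closed p q) = ∙-closed (⟨⟩-bind f p) (⟨⟩-bind f q)
  ⟨⟩-bind f (⁻¹-closed p)  = ⁻¹-closed (⟨⟩-bind f p)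

  ⟨⟩-leftQuotient : ∀ {P : Fin n → Set} {x y} → ⟨ P ⟩ x → ⟨ P ⟩ (x ∙ y) → ⟨ P ⟩ y
  ⟨⟩-leftQuotient {P} {x} {y} p q = subst ⟨ P ⟩ (\\-leftDividesʳ x y) (∙-closed (⁻¹-closed p) q)

  Range : ∀ {d} → (Fin d → Fin n) → Fin n → Set
  Range c x = ∃[ i ] c i ≡ x

  Others : ∀ {d} → (Fin d → Fin n) → Fin d → Fin n → Set
  Others c j x = ∃[ i ] i ≢ j × c i ≡ x

  record IsBasis (A : Fin n → Set) {d} (c : Fin d → Fin n) : Set where
    field
      member      : ∀ i → A (c i)
      generates   : ∀ {x} → A x → ⟨ Range c ⟩ x
      irredundant : ∀ j → ¬ ⟨ Others c j ⟩ (c j)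

  basis-exists : ∀ {A : Fin n → Set} d (c : Fin d → Fin n) → (∀ i → A (c i)) →
                 (∀ {x} → A x → ⟨ Range c ⟩ x) →
                 ¬ ¬ (∃₂ λ d (c : Fin d → Fin n) → IsBasis A c)
  basis-exists zero c member generates none =
    none (0 , c , record { member = member ; generates = generates ; irredundant = λ () })
  basis-exists {A} (suc d) c member generates none = none (suc d , c , record
    { member = member
    ; generates = generates
    ; irredundant = λ j redundant → basis-exists d (c ∘ punchIn j) (member ∘ punchIn j)
        (λ x∈ → ⟨⟩-bind (drop j redundant) (generates x∈)) none
    })
    where
    others : ∀ j {x} → Others c j x → ⟨ Range (c ∘ punchIn j) ⟩ x
    others j (i , i≢j , eq) =
      generator (punchOut (i≢j ∘ sym) , trans (cong c (Fin.punchIn-punchOut (i≢j ∘ sym))) eq)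

    drop : ∀ j → ⟨ Others c j ⟩ (c j) → ∀ {x} → Range c x → ⟨ Range (c ∘ punchIn j) ⟩ x
    drop j redundant (i , eq) with i Fin.≟ j
    ... | no i≢j   = others j (i , i≢j , eq)
    ... | yes refl = subst ⟨ _ ⟩ eq (⟨⟩-bind (others j) redundant)

  module Irredundant {d} {c : Fin d → Fin n} (irredundant : ∀ j → ¬ ⟨ Others c j ⟩ (c j)) where

    other : ∀ {i j} → i ≢ j → ⟨ Others c j ⟩ (c i)
    other {i} i≢j = generator (i , i≢j , refl)

    injective : ∀ {i j} → c i ≡ c j → i ≡ j
    injective {i} {j} eq with i Fin.≟ j
    ... | yes i≡j = i≡j
    ... | no i≢j  = contradiction (subst ⟨ _ ⟩ eq (other i≢j)) (irredundant j)

    ≢ε : ∀ {j} → c j ≢ ε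
    ≢ε {j} eq = irredundant j (subst ⟨ _ ⟩ (sym eq) ε-closed)

    ∙≢ε : ∀ {i j} → i ≢ j → c i ∙ c j ≢ ε
    ∙≢ε {i} {j} i≢j eq = irredundant j (⟨⟩-leftQuotient (other i≢j) (subst ⟨ _ ⟩ (sym eq) ε-closed))

    ∙≢ : ∀ {i j k} → c i ∙ c j ≢ c k
    ∙≢ {i} {j} {k} eq with i Fin.≟ k | j Fin.≟ k
    ... | yes refl | _        = ≢ε (∙-cancelˡ (c i) (c j) ε (trans eq (sym (identʳ (c i)))))
    ... | no _     | yes refl = ≢ε (∙-cancelʳ (c j) (c i) ε (trans eq (sym (identˡ (c j)))))
    ... | no i≢k   | no j≢k   = irredundant k (subst ⟨ _ ⟩ eq (∙-closed (other i≢k) (other j≢k)))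

    -- If `j` is `l`, cancelling gives `i ≡ k`. If `j` is neither `k` nor `l`, the equation
    -- expresses `c j` through other generators. If `j` is `k`, then `l` exceeds `i` and `j`, and
    -- `c l` is expressed through theirs.
    link-rigid : ∀ {i j k l} → toℕ i < toℕ j → toℕ l ≡ suc (toℕ k) →
                 c i ∙ c j ≡ c k ∙ c l → toℕ j ≡ suc (toℕ i)
    link-rigid {i} {j} {k} {l} i<j l≡k+1 eq with j Fin.≟ l | j Fin.≟ k
    ... | yes refl | _        = trans l≡k+1 (cong (suc ∘ toℕ) (sym (injective (∙-cancelʳ (c j) (c i) (c k) eq))))
    ... | no j≢l   | no j≢k   = contradiction
      (⟨⟩-leftQuotient (other (Fin.<⇒≢ i<j)) (subst ⟨ _ ⟩ (sym eq) (∙-closed (other (j≢k ∘ sym)) (other (j≢l ∘ sym)))))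
      (irredundant j)
    ... | no j≢l   | yes refl = contradiction
      (⟨⟩-leftQuotient (other (Fin.<⇒≢ j<l)) (subst ⟨ _ ⟩ eq (∙-closed (other (Fin.<⇒≢ (ℕ.<-trans i<j j<l))) (other (Fin.<⇒≢ j<l)))))
      (irredundant l)
      where
      j<l : toℕ j < toℕ l
      j<l = ℕ.≤-reflexive (sym l≡k+1)

-- Decidability under double negation, and subsets cut out by predicates.

¬¬-decidable : ∀ {n} (P : Fin n → Set) → ¬ ¬ (∀ x → Dec (P x))
¬¬-decidable P = Fin.sequence (RawMonad.rawApplicative ¬¬-Monad) (λ x → ¬¬-excluded-middle)

module _ {n} {P : Fin n → Set} (P? : ∀ x → Dec (P x)) where

  comprehension : Subset n
  comprehension = tabulate (does ∘ P?)

  ∈-comprehension⁺ : ∀ {x} → P x → x ∈ comprehension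
  ∈-comprehension⁺ {x} p =
    lookup⇒[]= x comprehension (trans (lookup∘tabulate (does ∘ P?) x) (dec-true (P? x) p))

  ∈-comprehension⁻ : ∀ {x} → x ∈ comprehension → P x
  ∈-comprehension⁻ {x} x∈ with P? x | trans (sym (lookup∘tabulate (does ∘ P?) x)) ([]=⇒lookup x∈)
  ... | yes p | _ = p
  ... | no _  | ()

-- Direct products of two characteristic subgroups.

record CharacteristicDecomposition {n : ℕ} (G : FinGroup n) : Set where
  open FinGroup G
  field
    π π′     : Fin n → Fin n
    π-hom    : ∀ x y → π (x ∙ y) ≡ π x ∙ π y
    π′-hom   : ∀ x y → π′ (x ∙ y) ≡ π′ x ∙ π′ y
    split    : ∀ x → π x ∙ π′ x ≡ x
    ππ′      : ∀ x → π (π′ x) ≡ ε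
    π′π      : ∀ x → π′ (π x) ≡ ε
    commute  : ∀ x y → π x ∙ π′ y ≡ π′ y ∙ π x
    -- Commuting with every automorphism is what makes the two factors characteristic.
    natural  : ∀ (φ : GroupAut G) x → GroupAut.to φ (π x) ≡ π (GroupAut.to φ x)
    natural′ : ∀ (φ : GroupAut G) x → GroupAut.to φ (π′ x) ≡ π′ (GroupAut.to φ x)

  flip : CharacteristicDecomposition G
  flip = record
    { π = π′ ; π′ = π ; π-hom = π′-hom ; π′-hom = π-hom
    ; split = λ x → trans (sym (commute x x)) (split x)
    ; ππ′ = π′π ; π′π = ππ′
    ; commute = λ x y → sym (commute y x)
    ; natural = natural′ ; natural′ = natural
    }

module Endomorphism {n : ℕ} (G : FinGroup n) where
  open FinGroup G
  open Algebra.Properties.Group (group G)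

  hom-ε : ∀ {f : Fin n → Fin n} → (∀ x y → f (x ∙ y) ≡ f x ∙ f y) → f ε ≡ ε
  hom-ε {f} hom = ∙-cancelˡ (f ε) (f ε) ε (trans (sym (hom ε ε)) (trans (cong f (identˡ ε)) (sym (identʳ (f ε)))))

  hom-⁻¹ : ∀ {f : Fin n → Fin n} → (∀ x y → f (x ∙ y) ≡ f x ∙ f y) → ∀ x → f (x ⁻¹) ≡ f x ⁻¹
  hom-⁻¹ {f} hom x = inverseʳ-unique (f x) (f (x ⁻¹))
    (trans (sym (hom x (x ⁻¹))) (trans (cong f (inverseʳ x)) (hom-ε hom)))

-- A connection set that is rigid but gives no DRR.

module Rigid {n : ℕ} (G : FinGroup n) (D : CharacteristicDecomposition G) where
  open FinGroup G
  open CharacteristicDecomposition D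
  open Algebra.Properties.Group (group G)
  open Generation G
  open Endomorphism G

  A B : Fin n → Set
  A x = π x ≡ x
  B x = π′ x ≡ x

  A⇒π′≡ε : ∀ {x} → A x → π′ x ≡ ε
  A⇒π′≡ε {x} x∈ = trans (cong π′ (sym x∈)) (π′π x)

  B⇒π≡ε : ∀ {x} → B x → π x ≡ ε
  B⇒π≡ε {x} x∈ = trans (cong π (sym x∈)) (ππ′ x)

  π∈A : ∀ x → A (π x)
  π∈A x = begin
    π (π x)               ≡⟨ identʳ (π (π x)) ⟨
    π (π x) ∙ ε           ≡⟨ cong (π (π x) ∙_) (π′π x) ⟨
    π (π x) ∙ π′ (π x)    ≡⟨ split (π x) ⟩
    π x                   ∎
    where open ≡-Reasoning

  module Construction {e d} {a : Fin (suc e) → Fin n} {b : Fin (suc d) → Fin n}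
                      (a-basis : IsBasis A a) (b-basis : IsBasis B b) (e≤d : e ≤ d) where
    open IsBasis
    private
      module a = Irredundant (irredundant a-basis)
      module b = Irredundant (irredundant b-basis)

    a₀ b₀ : Fin n
    a₀ = a Fin.zero
    b₀ = b Fin.zero

    -- For x in A and y in B, S x y says that x ∙ y lies in the connection set; y is full when
    -- the whole coset A y does.
    data Full (y : Fin n) : Set where
      top  : y ≡ b₀ → Full y
      link : ∀ i j → 1 ≤ toℕ i → toℕ j ≡ suc (toℕ i) → y ≡ b i ∙ b j → Full y

    data S (x y : Fin n) : Set where
      base  : x ≡ a₀ → y ≡ ε → S x y
      -- The index is given by an equation because there is no b₁ when `d` is 0.
      start : ∀ j → toℕ j ≡ 1 → x ≡ ε → y ≡ b j → S x y
      tail  : ∀ j → 2 ≤ toℕ j → x ≡ a₀ → y ≡ b j → S x y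
      diag  : ∀ i j → 1 ≤ toℕ j → toℕ i ≡ toℕ j → x ≡ a i → y ≡ b j → S x y
      full  : Full y → S x y

    private
      link-≢ : ∀ {i j : Fin (suc d)} → toℕ j ≡ suc (toℕ i) → i ≢ j
      link-≢ j≡i+1 = Fin.<⇒≢ (ℕ.≤-reflexive (sym j≡i+1))

      0-≢ : ∀ {m} {i : Fin (suc m)} → 1 ≤ toℕ i → Fin.zero ≢ i
      0-≢ 1≤ refl with () ← 1≤

      1-≢-2 : ∀ {i j : Fin (suc d)} → toℕ i ≡ 1 → 2 ≤ toℕ j → i ≢ j
      1-≢-2 i≡1 2≤j refl = ℕ.<⇒≢ 2≤j (sym i≡1)

    Full⇒≢ε : ∀ {y} → Full y → y ≢ ε
    Full⇒≢ε (top y≡) y≡ε = b.≢ε (trans (sym y≡) y≡ε)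
    Full⇒≢ε (link i j _ j≡i+1 y≡) y≡ε = b.∙≢ε (link-≢ j≡i+1) (trans (sym y≡) y≡ε)

    Full⇒≢b : ∀ {y} → Full y → ∀ j → 1 ≤ toℕ j → y ≢ b j
    Full⇒≢b (top y≡) j 1≤j y≡bj = 0-≢ 1≤j (b.injective (trans (sym y≡) y≡bj))
    Full⇒≢b (link _ _ _ _ y≡) j 1≤j y≡bj = b.∙≢ (trans (sym y≡) y≡bj)

    b≢ε : ∀ j {y} → y ≡ b j → y ≢ ε
    b≢ε j y≡bj y≡ε = b.≢ε (trans (sym y≡bj) y≡ε)

    ε≢a₀ : ε ≢ a₀
    ε≢a₀ = a.≢ε ∘ sym

    -- Every constructor except `base` forces `y ≢ ε`, so `a₀` is the only element of A in the
    -- connection set. This anchors the rigidity argument.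
    a₀-unique : ∀ {x} → S x ε → x ≡ a₀
    a₀-unique (base x≡a₀ _)       = x≡a₀
    a₀-unique (start j _ _ ε≡)    = contradiction refl (b≢ε j ε≡)
    a₀-unique (tail j _ _ ε≡)     = contradiction refl (b≢ε j ε≡)
    a₀-unique (diag _ j _ _ _ ε≡) = contradiction refl (b≢ε j ε≡)
    a₀-unique (full f)            = contradiction refl (Full⇒≢ε f)

    -- For y ≢ ε, being b₁, a later b j, or full is read off from the pair (S ε y, S a₀ y).
    start-colour : ∀ {y} → S ε y → ¬ S a₀ y → ∃[ j ] toℕ j ≡ 1 × y ≡ b j
    start-colour (base ε≡a₀ _) _          = contradiction ε≡a₀ ε≢a₀
    start-colour (start j j≡1 _ y≡) _     = j , j≡1 , y≡
    start-colour (tail _ _ ε≡a₀ _) _      = contradiction ε≡a₀ ε≢a₀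
    start-colour (diag _ _ _ _ ε≡ _) _    = contradiction (sym ε≡) a.≢ε
    start-colour (full f) ¬Sa₀y           = contradiction (full f) ¬Sa₀y

    a₀∉start : ∀ {j} → toℕ j ≡ 1 → ¬ S a₀ (b j)
    a₀∉start j≡1 (base _ bj≡ε)              = b.≢ε bj≡ε
    a₀∉start j≡1 (start _ _ a₀≡ε _)         = a.≢ε a₀≡ε
    a₀∉start j≡1 (tail k 2≤k _ bj≡bk)       = 1-≢-2 j≡1 2≤k (b.injective bj≡bk)
    a₀∉start j≡1 (diag i k 1≤k i≡k a₀≡ai _) = 0-≢ (subst (1 ≤_) (sym i≡k) 1≤k) (a.injective a₀≡ai)
    a₀∉start {j} j≡1 (full f)               = Full⇒≢b f j (ℕ.≤-reflexive (sym j≡1)) refl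

    tail-colour : ∀ {y} → S a₀ y → ¬ S ε y → y ≢ ε → ∃[ j ] 2 ≤ toℕ j × y ≡ b j
    tail-colour (base _ y≡ε) _ y≢ε                = contradiction y≡ε y≢ε
    tail-colour (start _ _ a₀≡ε _) _ _            = contradiction a₀≡ε a.≢ε
    tail-colour (tail j 2≤j _ y≡) _ _             = j , 2≤j , y≡
    tail-colour (diag i j 1≤j i≡j a₀≡ai _) _ _    =
      contradiction (a.injective a₀≡ai) (0-≢ (subst (1 ≤_) (sym i≡j) 1≤j))
    tail-colour (full f) ¬Sεy _                   = contradiction (full f) ¬Sεy

    ε∉tail : ∀ {j} → 2 ≤ toℕ j → ¬ S ε (b j)
    ε∉tail 2≤j (base ε≡a₀ _)         = ε≢a₀ ε≡a₀
    ε∉tail 2≤j (start k k≡1 _ bj≡bk) = 1-≢-2 k≡1 2≤j (sym (b.injective bj≡bk))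
    ε∉tail 2≤j (tail _ _ ε≡a₀ _)     = ε≢a₀ ε≡a₀
    ε∉tail 2≤j (diag _ _ _ _ ε≡ _)   = a.≢ε (sym ε≡)
    ε∉tail {j} 2≤j (full f)          = Full⇒≢b f j (ℕ.≤-trans (s≤s z≤n) 2≤j) refl

    full-colour : ∀ {y} → S ε y → S a₀ y → Full y
    full-colour (full f) _                     = f
    full-colour (base ε≡a₀ _) _                = contradiction ε≡a₀ ε≢a₀
    full-colour (tail _ _ ε≡a₀ _) _            = contradiction ε≡a₀ ε≢a₀
    full-colour (diag _ _ _ _ ε≡ _) _          = contradiction (sym ε≡) a.≢ε
    full-colour (start j j≡1 _ refl) Sa₀       = contradiction Sa₀ (a₀∉start j≡1)

    module Automorphism (f : Fin n → Fin n) (f-hom : ∀ x y → f (x ∙ y) ≡ f x ∙ f y)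
                        (f-injective : ∀ {x y} → f x ≡ f y → x ≡ y)
                        (S⇔ : ∀ {x y} → A x → B y → S x y ⇔ S (f x) (f y)) where
      private
        f-ε : f ε ≡ ε
        f-ε = hom-ε f-hom

        A-ε : A ε
        A-ε = hom-ε π-hom

        B-ε : B ε
        B-ε = hom-ε π′-hom

        B-∙ : ∀ {x y} → B x → B y → B (x ∙ y)
        B-∙ x∈ y∈ = trans (π′-hom _ _) (cong₂ _∙_ x∈ y∈)

        a∈ : ∀ i → A (a i)
        a∈ = member a-basis

        b∈ : ∀ j → B (b j)
        b∈ = member b-basis

      fix-a₀ : f a₀ ≡ a₀
      fix-a₀ = a₀-unique (subst (S (f a₀)) f-ε (Equivalence.to (S⇔ (a∈ Fin.zero) B-ε) (base refl refl)))

      -- As `f` fixes `ε` and `a₀`, the pair (`S ε y`, `S a₀ y`) is an invariant of `y` under `f`;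
      -- the colour lemmas then apply to `f y`.
      S-ε : ∀ {y} → B y → S ε y ⇔ S ε (f y)
      S-ε {y} y∈ = subst (λ x → S ε y ⇔ S x (f y)) f-ε (S⇔ A-ε y∈)

      S-a₀ : ∀ {y} → B y → S a₀ y ⇔ S a₀ (f y)
      S-a₀ {y} y∈ = subst (λ x → S a₀ y ⇔ S x (f y)) fix-a₀ (S⇔ (a∈ Fin.zero) y∈)

      open Equivalence using (to; from)

      preserves-Full : ∀ {y} → B y → Full y → Full (f y)
      preserves-Full y∈ fy = full-colour (to (S-ε y∈) (full fy)) (to (S-a₀ y∈) (full fy))

      fix-b₁ : ∀ j → toℕ j ≡ 1 → f (b j) ≡ b j
      fix-b₁ j j≡1 with start-colour (to (S-ε (b∈ j)) (start j j≡1 refl refl))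
                                     (a₀∉start j≡1 ∘ from (S-a₀ (b∈ j)))
      ... | k , k≡1 , eq = trans eq (cong b (Fin.toℕ-injective (trans k≡1 (sym j≡1))))

      permutes-tail : ∀ j → 2 ≤ toℕ j → ∃[ l ] 2 ≤ toℕ l × f (b j) ≡ b l
      permutes-tail j 2≤j = tail-colour (to (S-a₀ (b∈ j)) (tail j 2≤j refl refl))
        (ε∉tail 2≤j ∘ from (S-ε (b∈ j))) (λ fbj≡ε → b.≢ε (f-injective (trans fbj≡ε (sym f-ε))))

      -- b i ∙ b l is again a link, which forces l = i + 1.
      fix-next : ∀ i j → 1 ≤ toℕ i → toℕ j ≡ suc (toℕ i) →
                 (∀ k → 1 ≤ toℕ k → toℕ k ≤ toℕ i → f (b k) ≡ b k) → f (b j) ≡ b j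
      fix-next i j 1≤i j≡i+1 fixed with permutes-tail j (subst (2 ≤_) (sym j≡i+1) (s≤s 1≤i))
      ... | l , 2≤l , fbj≡bl with ℕ.≤-<-connex (toℕ l) (toℕ i)
      -- Here `b l` is already fixed, so `f` sends `b j` and `b l` to the same element, and
      -- injectivity identifies them.
      ...   | inj₁ l≤i = trans fbj≡bl (sym (f-injective
              (trans fbj≡bl (sym (fixed l (ℕ.≤-trans (s≤s z≤n) 2≤l) l≤i)))))
      ...   | inj₂ i<l = trans fbj≡bl (cong b (Fin.toℕ-injective (trans (l≡i+1 full-bibl) (sym j≡i+1))))
        where
        full-bibl : Full (b i ∙ b l)
        full-bibl = subst Full (trans (f-hom (b i) (b j)) (cong₂ _∙_ (fixed i 1≤i ℕ.≤-refl) fbj≡bl))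
          (preserves-Full (B-∙ (b∈ i) (b∈ j)) (link i j 1≤i j≡i+1 refl))
        l≡i+1 : Full (b i ∙ b l) → toℕ l ≡ suc (toℕ i)
        l≡i+1 (top eq)                = contradiction eq b.∙≢
        l≡i+1 (link k k′ _ k′≡k+1 eq) = b.link-rigid i<l k′≡k+1 eq

      fix-b≤ : ∀ N j → 1 ≤ toℕ j → toℕ j ≤ N → f (b j) ≡ b j
      fix-b≤ zero j 1≤j j≤0 = contradiction (ℕ.≤-trans 1≤j j≤0) λ ()
      fix-b≤ (suc N) j 1≤j j≤N+1 with ℕ.m≤n⇒m<n∨m≡n j≤N+1
      ... | inj₁ j<N+1 = fix-b≤ N j 1≤j (ℕ.≤-pred j<N+1)
      fix-b≤ (suc zero)      j _ _ | inj₂ j≡1 = fix-b₁ j j≡1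
      fix-b≤ (suc N@(suc _)) j _ _ | inj₂ j≡N+1 = fix-next i j (subst (1 ≤_) (sym i≡N) (s≤s z≤n))
        (trans j≡N+1 (cong suc (sym i≡N)))
        (λ k 1≤k k≤i → fix-b≤ N k 1≤k (subst (toℕ k ≤_) i≡N k≤i))
        where
        N<d+1 : N < suc d
        N<d+1 = ℕ.<-trans (ℕ.≤-reflexive (sym j≡N+1)) (Fin.toℕ<n j)
        i : Fin (suc d)
        i = fromℕ< N<d+1
        i≡N : toℕ i ≡ N
        i≡N = Fin.toℕ-fromℕ< N<d+1

      fix-b⁺ : ∀ j → 1 ≤ toℕ j → f (b j) ≡ b j
      fix-b⁺ j 1≤j = fix-b≤ (toℕ j) j 1≤j ℕ.≤-refl

      -- The image of `b₀` is full. Links are fixed by now, so an image that is a link would make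
      -- `b₀` itself a link, which irredundance excludes.
      fix-b₀ : f b₀ ≡ b₀
      fix-b₀ with preserves-Full (b∈ Fin.zero) (top refl)
      ... | top eq = eq
      ... | link i j 1≤i j≡i+1 eq = contradiction (f-injective (begin
        f (b i ∙ b j)      ≡⟨ f-hom (b i) (b j) ⟩
        f (b i) ∙ f (b j)  ≡⟨ cong₂ _∙_ (fix-b⁺ i 1≤i) (fix-b⁺ j (subst (1 ≤_) (sym j≡i+1) (s≤s z≤n))) ⟩
        b i ∙ b j          ≡⟨ eq ⟨
        f b₀               ∎)) b.∙≢
        where open ≡-Reasoning

      fix-b : ∀ j → f (b j) ≡ b j
      fix-b Fin.zero    = fix-b₀
      fix-b (Fin.suc j) = fix-b⁺ (Fin.suc j) (s≤s z≤n)

      -- `diag` ties each later `a i` to a fixed `b j` of the same index; `e ≤ d` supplies this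
      -- partner. The other way into `S` over `b j`, by `tail`, would send `a i` to `a₀`, which is
      -- taken.
      fix-a : ∀ i → f (a i) ≡ a i
      fix-a Fin.zero      = fix-a₀
      fix-a i@(Fin.suc _) = go (subst (S (f (a i))) (fix-b j)
                                 (to (S⇔ (a∈ i) (b∈ j)) (diag i j 1≤j (sym j≡i) refl refl)))
        where
        j : Fin (suc d)
        j = inject≤ i (s≤s e≤d)
        j≡i : toℕ j ≡ toℕ i
        j≡i = Fin.toℕ-inject≤ i (s≤s e≤d)
        1≤j : 1 ≤ toℕ j
        1≤j = subst (1 ≤_) (sym j≡i) (s≤s z≤n)
        go : S (f (a i)) (b j) → f (a i) ≡ a i
        go (base _ bj≡ε)       = contradiction bj≡ε b.≢ε
        go (start _ _ fai≡ε _) = contradiction (f-injective (trans fai≡ε (sym f-ε))) a.≢ε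
        go (tail _ _ fai≡a₀ _) =
          contradiction (a.injective {i} {Fin.zero} (f-injective (trans fai≡a₀ (sym fix-a₀)))) λ ()
        go (diag k l _ k≡l fai≡ak bj≡bl) = trans fai≡ak (cong a (Fin.toℕ-injective
          (trans k≡l (trans (cong toℕ (sym (b.injective bj≡bl))) j≡i))))
        go (full fl)           = contradiction refl (Full⇒≢b fl j 1≤j)

      fix-⟨⟩ : ∀ {d} {c : Fin d → Fin n} → (∀ i → f (c i) ≡ c i) → ∀ {x} → ⟨ Range c ⟩ x → f x ≡ x
      fix-⟨⟩ fix-c (generator (i , refl)) = fix-c i
      fix-⟨⟩ fix-c ε-closed               = f-ε
      fix-⟨⟩ fix-c (∙-closed {x} {y} p q) = trans (f-hom x y) (cong₂ _∙_ (fix-⟨⟩ fix-c p) (fix-⟨⟩ fix-c q))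
      fix-⟨⟩ fix-c (⁻¹-closed {x} p)      = trans (hom-⁻¹ f-hom x) (cong _⁻¹ (fix-⟨⟩ fix-c p))

      fix-A : ∀ {x} → A x → f x ≡ x
      fix-A x∈ = fix-⟨⟩ fix-a (generates a-basis x∈)

      fix-B : ∀ {x} → B x → f x ≡ x
      fix-B x∈ = fix-⟨⟩ fix-b (generates b-basis x∈)

    B′ : Fin n → Set
    B′ = ⟨ (λ x → ∃[ j ] 1 ≤ toℕ j × b j ≡ x) ⟩

    b∈B′ : ∀ j → 1 ≤ toℕ j → B′ (b j)
    b∈B′ j 1≤j = generator (j , 1≤j , refl)

    b₀∉B′ : ¬ B′ b₀
    b₀∉B′ = irredundant b-basis Fin.zero ∘ ⟨⟩-bind λ { (j , 1≤j , eq) → generator (j , 0-≢ 1≤j ∘ sym , eq) }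

    -- All constructors but `full` place `y` in `B′`, and `full` leaves `x` free: outside A × `B′`
    -- the connection set consists of whole cosets of A.
    S-outside-B′ : ∀ {x y} → ¬ B′ y → S x y → Full y
    S-outside-B′ y∉ (base _ refl)               = contradiction ε-closed y∉
    S-outside-B′ y∉ (start j j≡1 _ refl)        = contradiction (b∈B′ j (ℕ.≤-reflexive (sym j≡1))) y∉
    S-outside-B′ y∉ (tail j 2≤j _ refl)         = contradiction (b∈B′ j (ℕ.≤-trans (s≤s z≤n) 2≤j)) y∉
    S-outside-B′ y∉ (diag _ j 1≤j _ _ refl)     = contradiction (b∈B′ j 1≤j) y∉
    S-outside-B′ y∉ (full fy)                   = fy

    module Twist (B′? : ∀ x → Dec (B′ x)) (S? : ∀ x → Dec (S (π x) (π′ x))) where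

      connection : Subset n
      connection = comprehension S?

      -- Multiplication is on the right, so it commutes with the left multiplications that define
      -- edges; only edges between the two regions need care.
      twist : Fin n → Fin n → Fin n
      twist u x with B′? (π′ x)
      ... | yes _ = x ∙ u
      ... | no _  = x

      twist-∈ : ∀ u {x} → B′ (π′ x) → twist u x ≡ x ∙ u
      twist-∈ u {x} x∈ with B′? (π′ x)
      ... | yes _ = refl
      ... | no x∉ = contradiction x∈ x∉

      twist-∉ : ∀ u {x} → ¬ B′ (π′ x) → twist u x ≡ x
      twist-∉ u {x} x∉ with B′? (π′ x)
      ... | yes x∈ = contradiction x∈ x∉
      ... | no _   = refl

      twist-inverse : ∀ {u v} → A u → u ∙ v ≡ ε → ∀ x → twist v (twist u x) ≡ x
      twist-inverse {u} {v} u∈ uv≡ε x with B′? (π′ x)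
      ... | no x∉ = twist-∉ v x∉
      ... | yes x∈ = begin
        twist v (x ∙ u)  ≡⟨ twist-∈ v (subst B′ (sym π′xu≡π′x) x∈) ⟩
        x ∙ u ∙ v        ≡⟨ assoc x u v ⟩
        x ∙ (u ∙ v)      ≡⟨ cong (x ∙_) uv≡ε ⟩
        x ∙ ε            ≡⟨ identʳ x ⟩
        x                ∎
        where
        open ≡-Reasoning
        π′xu≡π′x : π′ (x ∙ u) ≡ π′ x
        π′xu≡π′x = trans (π′-hom x u) (trans (cong (π′ x ∙_) (A⇒π′≡ε u∈)) (identʳ (π′ x)))

      -- Outside A × B′ the connection set is a union of cosets of A, so conjugates of
      -- elements of A may be inserted.
      shift-∈ : ∀ {s v} x → A v → ¬ B′ (π′ s) → s ∈ connection → (s ∙ (x ∙ v ∙ x ⁻¹)) ∈ connection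
      shift-∈ {s} {v} x v∈ s∉ s∈ = ∈-comprehension⁺ S? (full (subst Full (sym π′≡)
        (S-outside-B′ s∉ (∈-comprehension⁻ S? s∈))))
        where
        open ≡-Reasoning
        π′≡ : π′ (s ∙ (x ∙ v ∙ x ⁻¹)) ≡ π′ s
        π′≡ = begin
          π′ (s ∙ (x ∙ v ∙ x ⁻¹))         ≡⟨ π′-hom s _ ⟩
          π′ s ∙ π′ (x ∙ v ∙ x ⁻¹)        ≡⟨ cong (π′ s ∙_) (π′-hom (x ∙ v) (x ⁻¹)) ⟩
          π′ s ∙ (π′ (x ∙ v) ∙ π′ (x ⁻¹)) ≡⟨ cong (λ w → π′ s ∙ (w ∙ π′ (x ⁻¹))) (π′-hom x v) ⟩
          π′ s ∙ (π′ x ∙ π′ v ∙ π′ (x ⁻¹)) ≡⟨ cong₂ (λ w w′ → π′ s ∙ (π′ x ∙ w ∙ w′)) (A⇒π′≡ε v∈) (hom-⁻¹ π′-hom x) ⟩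
          π′ s ∙ (π′ x ∙ ε ∙ π′ x ⁻¹)     ≡⟨ cong (λ w → π′ s ∙ (w ∙ π′ x ⁻¹)) (identʳ (π′ x)) ⟩
          π′ s ∙ (π′ x ∙ π′ x ⁻¹)         ≡⟨ cong (π′ s ∙_) (inverseʳ (π′ x)) ⟩
          π′ s ∙ ε                        ≡⟨ identʳ (π′ s) ⟩
          π′ s                            ∎

      A-⁻¹ : ∀ {u} → A u → A (u ⁻¹)
      A-⁻¹ {u} u∈ = trans (hom-⁻¹ π-hom u) (cong _⁻¹ u∈)

      conj-cancel : ∀ s x v → s ∙ (x ∙ v ∙ x ⁻¹) ∙ x ≡ s ∙ x ∙ v
      conj-cancel s x v = begin
        s ∙ (x ∙ v ∙ x ⁻¹) ∙ x    ≡⟨ assoc s (x ∙ v ∙ x ⁻¹) x ⟩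
        s ∙ (x ∙ v ∙ x ⁻¹ ∙ x)    ≡⟨ cong (s ∙_) (//-rightDividesˡ x (x ∙ v)) ⟩
        s ∙ (x ∙ v)               ≡⟨ assoc s x v ⟨
        s ∙ x ∙ v                 ∎
        where open ≡-Reasoning

      -- Within a region the label `s` is kept. An edge between the regions has `s` outside A ×
      -- `B′`, so `s` may absorb the conjugate of `u` or `u ⁻¹` that corrects the one moved
      -- endpoint.
      twist-edge : ∀ {u} → A u → ∀ {x y} → CayEdge G connection x y → CayEdge G connection (twist u x) (twist u y)
      twist-edge {u} u∈ {x} (s , s∈ , refl) with B′? (π′ x) | B′? (π′ (s ∙ x))
      ... | yes _  | yes _   = s , s∈ , assoc s x u
      ... | no _   | no _    = s , s∈ , refl
      ... | yes x∈ | no sx∉ = s ∙ (x ∙ u ⁻¹ ∙ x ⁻¹) , shift-∈ x (A-⁻¹ u∈) s∉ s∈ , (begin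
        s ∙ x                                ≡⟨ //-rightDividesˡ u (s ∙ x) ⟨
        s ∙ x ∙ u ⁻¹ ∙ u                     ≡⟨ cong (_∙ u) (conj-cancel s x (u ⁻¹)) ⟨
        s ∙ (x ∙ u ⁻¹ ∙ x ⁻¹) ∙ x ∙ u        ≡⟨ assoc _ x u ⟩
        s ∙ (x ∙ u ⁻¹ ∙ x ⁻¹) ∙ (x ∙ u)      ∎)
        where
        open ≡-Reasoning
        s∉ : ¬ B′ (π′ s)
        s∉ s∈ = sx∉ (subst B′ (sym (π′-hom s x)) (∙-closed s∈ x∈))
      ... | no x∉ | yes sx∈ = s ∙ (x ∙ u ∙ x ⁻¹) , shift-∈ x u∈ s∉ s∈ , sym (conj-cancel s x u)
        where
        s∉ : ¬ B′ (π′ s)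
        s∉ s∈ = x∉ (⟨⟩-leftQuotient s∈ (subst B′ (π′-hom s x) sx∈))

      a₀∈ : A a₀
      a₀∈ = member a-basis Fin.zero

      twist-aut : DigraphAut (CayEdge G connection)
      twist-aut = record
        { to = twist a₀
        ; from = twist (a₀ ⁻¹)
        ; to-from = twist-inverse (A-⁻¹ a₀∈) (inverseˡ a₀)
        ; from-to = from-to
        ; arcs = λ x y → mk⇔ (twist-edge a₀∈) λ edge →
            subst₂ (CayEdge G connection) (from-to x) (from-to y) (twist-edge (A-⁻¹ a₀∈) edge)
        }
        where
        from-to : ∀ x → twist (a₀ ⁻¹) (twist a₀ x) ≡ x
        from-to = twist-inverse a₀∈ (inverseʳ a₀)

      identity-aut : DigraphAut (CayEdge G connection)
      identity-aut = record
        { to = id ; from = id ; to-from = λ _ → refl ; from-to = λ _ → refl ; arcs = λ _ _ → mk⇔ id id }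

      -- The twist by `a₀` agrees with the identity at `b₀` but moves `ε`.
      not-regular : ¬ IsDRR G connection
      not-regular (_ , unique) = a.≢ε (begin
        a₀             ≡⟨ identˡ a₀ ⟨
        ε ∙ a₀         ≡⟨ twist-∈ a₀ (subst B′ (sym (hom-ε π′-hom)) ε-closed) ⟨
        twist a₀ ε     ≡⟨ unique twist-aut identity-aut b₀ twist-b₀ ε ⟩
        ε              ∎)
        where
        open ≡-Reasoning
        twist-b₀ : twist a₀ b₀ ≡ b₀
        twist-b₀ = twist-∉ a₀ (b₀∉B′ ∘ subst B′ (member b-basis Fin.zero))

      -- Naturality of the projections keeps `f` inside each factor, so stabilising the connection
      -- set becomes `S⇔` in coordinates; then `f` fixes both factors pointwise.
      rigid : AutGS-trivial G connection
      rigid φ stabilises x = begin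
        f x                     ≡⟨ cong f (split x) ⟨
        f (π x ∙ π′ x)          ≡⟨ hom (π x) (π′ x) ⟩
        f (π x) ∙ f (π′ x)      ≡⟨ cong₂ _∙_ (fix-A (π∈A x)) (fix-B π′∈B) ⟩
        π x ∙ π′ x              ≡⟨ split x ⟩
        x                       ∎
        where
        open ≡-Reasoning
        open GroupAut φ using (from; from-to; hom) renaming (to to f)
        f-injective : ∀ {x y} → f x ≡ f y → x ≡ y
        f-injective {x} {y} eq = trans (sym (from-to x)) (trans (cong from eq) (from-to y))

        π-∙ : ∀ {x y} → A x → B y → π (x ∙ y) ≡ x
        π-∙ {x} {y} x∈ y∈ = trans (π-hom x y) (trans (cong₂ _∙_ x∈ (B⇒π≡ε y∈)) (identʳ x))

        π′-∙ : ∀ {x y} → A x → B y → π′ (x ∙ y) ≡ y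
        π′-∙ {x} {y} x∈ y∈ = trans (π′-hom x y) (trans (cong₂ _∙_ (A⇒π′≡ε x∈) y∈) (identˡ y))

        π′∈B : B (π′ x)
        π′∈B = trans (sym (identˡ _)) (trans (cong (_∙ π′ (π′ x)) (sym (ππ′ x))) (split (π′ x)))

        f-A : ∀ {x} → A x → A (f x)
        f-A {x} x∈ = trans (sym (natural φ x)) (cong f x∈)

        f-B : ∀ {x} → B x → B (f x)
        f-B {x} x∈ = trans (sym (natural′ φ x)) (cong f x∈)

        connection⇔S : ∀ {x y} → A x → B y → (x ∙ y) ∈ connection ⇔ S x y
        connection⇔S x∈ y∈ = mk⇔
          (subst₂ S (π-∙ x∈ y∈) (π′-∙ x∈ y∈) ∘ ∈-comprehension⁻ S?)
          (∈-comprehension⁺ S? ∘ subst₂ S (sym (π-∙ x∈ y∈)) (sym (π′-∙ x∈ y∈)))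

        S⇔ : ∀ {x y} → A x → B y → S x y ⇔ S (f x) (f y)
        S⇔ {x} {y} x∈ y∈ = mk⇔
          (λ s → to (connection⇔S (f-A x∈) (f-B y∈)) (subst (_∈ connection) (hom x y)
                   (to (stabilises (x ∙ y)) (Equivalence.from (connection⇔S x∈ y∈) s))))
          (λ s → to (connection⇔S x∈ y∈) (Equivalence.from (stabilises (x ∙ y)) (subst (_∈ connection)
                   (sym (hom x y)) (Equivalence.from (connection⇔S (f-A x∈) (f-B y∈)) s))))
          where open Equivalence using (to)

        open Automorphism f hom f-injective S⇔

    not-DRR-detecting : ¬ DRRDetecting G
    not-DRR-detecting detecting =
      -- The goal is a negation, so both predicates may be taken to be decidable.
      ¬¬-decidable B′ λ B′? → ¬¬-decidable (λ x → S (π x) (π′ x)) λ S? →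
      Twist.not-regular B′? S? (detecting (Twist.connection B′? S?) (Twist.rigid B′? S?))

-- From decompositions to the theorem.

decomposable⇒¬DRR-detecting : ∀ {n} (G : FinGroup n) (D : CharacteristicDecomposition G) →
  ∃ (λ x → CharacteristicDecomposition.π D x ≢ FinGroup.ε G) →
  ∃ (λ y → CharacteristicDecomposition.π′ D y ≢ FinGroup.ε G) → ¬ DRRDetecting G
decomposable⇒¬DRR-detecting G D (x , πx≢ε) (y , π′y≢ε) detecting =
  -- The family `π`, indexed by all of `Fin n`, has range A and is thinned to a basis. Nontriviality
  -- of the factors excludes empty bases.
  basis-exists _ π π∈A (λ {x} x∈ → generator (x , x∈)) λ where
    (zero , a , a-basis) → πx≢ε (⟨∅⟩ (generates a-basis (π∈A x)))
    (suc e , a , a-basis) → basis-exists _ π′ π′∈B (λ {y} y∈ → generator (y , y∈)) λ where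
      (zero , b , b-basis) → π′y≢ε (⟨∅⟩ (generates b-basis (π′∈B y)))
      (suc d , b , b-basis) → compare a-basis b-basis (ℕ.≤-total e d)
  where
  open FinGroup G
  open CharacteristicDecomposition D
  open Generation G
  open IsBasis
  open Rigid G D using (A; B; π∈A)
  module Flipped = Rigid G flip
  open Flipped using () renaming (π∈A to π′∈B)
  open Algebra.Properties.Group (group G)

  ⟨∅⟩ : ∀ {c : Fin 0 → Fin _} {x} → ⟨ Range c ⟩ x → x ≡ ε
  ⟨∅⟩ ε-closed       = refl
  ⟨∅⟩ (∙-closed p q) = trans (cong₂ _∙_ (⟨∅⟩ p) (⟨∅⟩ q)) (identˡ ε)
  ⟨∅⟩ (⁻¹-closed p)  = trans (cong _⁻¹ (⟨∅⟩ p)) ε⁻¹≈ε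

  -- The construction wants the shorter basis in the first factor; flipping the decomposition
  -- arranges this.
  compare : ∀ {e d} {a : Fin (suc e) → Fin _} {b : Fin (suc d) → Fin _} →
            IsBasis A a → IsBasis B b → (e ≤ d) ⊎ (d ≤ e) → _
  compare a-basis b-basis (inj₁ e≤d) = Rigid.Construction.not-DRR-detecting G D a-basis b-basis e≤d detecting
  compare a-basis b-basis (inj₂ d≤e) = Flipped.Construction.not-DRR-detecting b-basis a-basis d≤e detecting

module _ {n : ℕ} (G : FinGroup n) (nilpotent : Nilpotent G) where
  open FinGroup G
  open GroupPowers (group G)
  open ComplementaryPowers G
  open Exponents G

  aut-⋆ : ∀ (φ : GroupAut G) k x → GroupAut.to φ (k ⋆ x) ≡ k ⋆ GroupAut.to φ x
  aut-⋆ φ zero    x = Endomorphism.hom-ε G (GroupAut.hom φ)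
  aut-⋆ φ (suc k) x = trans (hom x (k ⋆ x)) (cong (to x ∙_) (aut-⋆ φ k x))
    where open GroupAut φ

  powerDecomposition : ∀ {m m′} → Complementary m m′ → CharacteristicDecomposition G
  powerDecomposition {m} {m′} c = record
    { π = m ⋆_ ; π′ = m′ ⋆_
    ; π-hom = ⋆-hom nilpotent c ; π′-hom = ⋆-hom nilpotent (swap c)
    ; split = split
    ; ππ′ = annihilate ; π′π = annihilate′
    ; commute = fixed-commute nilpotent c
    ; natural = λ φ → aut-⋆ φ m ; natural′ = λ φ → aut-⋆ φ m′
    }
    where open Complementary c

  trivial⇒pGroup : (∀ x → x ≡ ε) → IsPGroup G
  -- Any prime would serve; the exponent is `2 ^ 0`.
  trivial⇒pGroup trivial = 2 , prime[2] , p-power-order prime[2] nilpotent {0} (λ x → trivial (1 ⋆ x))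

  trivial-subgroup : IsSubgroup (_≡ ε)
  trivial-subgroup = record { ε-closed = refl ; ∙-closed = λ { refl refl → identˡ ε } }

  module _ {p k b y} (p-prime : Prime p) (p⊥b : Coprime p b) (pᵏb-exponent : ∀ x → (p ^ k * b) ⋆ x ≡ ε)
           (y≢ε : y ≢ ε) (py≡ε : p ⋆ y ≡ ε) (e : IdempotentExponents (p ^ k) b) where
    open IdempotentExponents e

    private
      c′ : Complementary m m′
      c′ = complementary pᵏb-exponent e

    open Complementary c′

    -- Otherwise `m′` fixes `y`, and since `p ^ k` divides `m′`, `b` kills `y`. So does `p`, which
    -- is coprime to `b`.
    p-part-nontrivial : m ⋆ y ≢ ε
    p-part-nontrivial my≡ε = y≢ε (IsSubgroup.coprime-powers trivial-subgroup p⊥b py≡ε (begin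
      b ⋆ y         ≡⟨ cong (b ⋆_) (Complementary.killed⇒fixed (swap c′) my≡ε) ⟨
      b ⋆ m′ ⋆ y    ≡⟨ ×-assocˡ y b m′ ⟩
      (b * m′) ⋆ y  ≡⟨ ∣-⋆ (subst (_∣ b * m′) (ℕ.*-comm b (p ^ k)) (*-monoʳ-∣ b a∣m′)) (pᵏb-exponent y) ⟩
      ε             ∎))
      where open ≡-Reasoning

    -- Now `m` acts as the identity, and `p ^ k * m` is a multiple of the exponent `p ^ k * b`.
    p′-part-trivial⇒pGroup : (∀ x → m′ ⋆ x ≡ ε) → IsPGroup G
    p′-part-trivial⇒pGroup killed = p , p-prime , p-power-order p-prime nilpotent {k} λ x → begin
      (p ^ k) ⋆ x       ≡⟨ cong ((p ^ k) ⋆_) (killed⇒fixed (killed x)) ⟨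
      (p ^ k) ⋆ m ⋆ x   ≡⟨ ×-assocˡ x (p ^ k) m ⟩
      (p ^ k * m) ⋆ x   ≡⟨ ∣-⋆ (*-monoʳ-∣ (p ^ k) b∣m) (pᵏb-exponent x) ⟩
      ε                 ∎
      where open ≡-Reasoning

    DRR-detecting⇒pGroup : DRRDetecting G → IsPGroup G
    DRR-detecting⇒pGroup detecting with Fin.any? (λ x → ¬? (m′ ⋆ x Fin.≟ ε))
    ... | no none = p′-part-trivial⇒pGroup λ x → decidable-stable (m′ ⋆ x Fin.≟ ε) λ ≢ε → none (x , ≢ε)
    ... | yes p′-part-nontrivial = contradiction detecting
      (decomposable⇒¬DRR-detecting G (powerDecomposition c′) (y , p-part-nontrivial) p′-part-nontrivial)

theorem1p10 : ∀ (n : ℕ) (G : FinGroup n) → Nilpotent G → DRRDetecting G → IsPGroup G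
theorem1p10 n G nilpotent detecting with Fin.any? (λ x → ¬? (x Fin.≟ ε))
  where open FinGroup G
... | no trivial = trivial⇒pGroup G nilpotent λ x → decidable-stable (x Fin.≟ _) λ ≢ε → trivial (x , ≢ε)
... | yes (x , x≢ε) = nontrivial (factorise (n !) {{n ℕ.!≢0}})
  where
  open Exponents G
  nontrivial : PrimeFactorisation (n !) → IsPGroup G
  nontrivial record { factors = ps ; isFactorisation = n!≡ ; factorsPrime = ps-prime }
    -- The prime is obtained together with an element `y` that it kills, so its part of `G` is
    -- nontrivial.
    with prime-order-element ps-prime (subst (λ k → GroupPowers._⋆_ (group G) k x ≡ _) n!≡ (exponent x)) x≢ε
  ... | p , y , p-prime , y≢ε , py≡ε with prime-part p-prime ps-prime
  ...   | k , b , ps≡pᵏb , p⊥b = DRR-detecting⇒pGroup G nilpotent {k = k} p-prime p⊥b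
    (λ x → subst (λ k → GroupPowers._⋆_ (group G) k x ≡ _) n!≡pᵏb (exponent x)) y≢ε py≡ε
    (coprime⇒idempotentExponents {{subst NonZero n!≡pᵏb (n ℕ.!≢0)}} (coprime-^ k p⊥b)) detecting
    where
    n!≡pᵏb : n ! ≡ p ^ k * b
    n!≡pᵏb = trans n!≡ ps≡pᵏb
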